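{- Let $G=(V,E)$ be a simple, strongly connected and balanced directed graph on $V=\{1,\dots,n\}$, with Laplacian $L$ and resistance matrix $R=[r_{ij}]$. Then: (i) for all non-empty $\Omega_1,\Omega_2\subseteq\{1,\dots,n\}$ with $\eta:=|\Omega_1|=|\Omega_2|$, \[\operatorname{cofsum}(R[\Omega_1,\Omega_2])=(-1)^{\alpha(\Omega_1)+\alpha(\Omega_2)+\eta-1}\frac{2^{\eta-1}}{\kappa(G)}\det\big(L[\Omega_2^c,\Omega_1^c]\big);\] (ii) for all distinct $i,j\in\{1,\dots,n\}$, \[r_{ij}+r_{ji}=\frac{2}{\kappa(G)}\det\big(L[\{i,j\}^c,\{i,j\}^c]\big).\]
   Context: For a simple directed graph $G=(V,E)$, the adjacency matrix is $A=[a_{ij}]$ with $a_{ij}=1$ if $(i,j)\in E$ and $0$ otherwise. $G$ is balanced if every vertex has indegree equal to outdegree; strongly connected if every ordered pair of vertices is joined by a directed path. The Laplacian is $L=\operatorname{Diag}(A\mathbf{1})-A$ ($\mathbf{1}$ the all-ones vector). With $L^\dagger=[l^\dagger_{ij}]$ the Moore–Penrose inverse, $r_{ij}=l^\dagger_{ii}+l^\dagger_{jj}-2l^\dagger_{ij}$ and $R=[r_{ij}]$. An oriented spanning tree rooted at $i$ is a spanning subgraph with no oriented cycles in which $i$ has outdegree $0$ and every other vertex has outdegree $1$; for strongly connected balanced $G$ their number does not depend on $i$ and is denoted $\kappa(G)$. $W[\Omega_1,\Omega_2]$ is the submatrix with rows indexed by $\Omega_1$ and columns by $\Omega_2$; $\Omega^c$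 is the complement in $\{1,\dots,n\}$; $\alpha(\Omega)$ is the sum of the elements of $\Omega$. $\operatorname{cofsum}(B)=\mathbf{1}'\operatorname{adj}(B)\mathbf{1}$ is the sum of all cofactors of $B$. The determinant of a $0\times0$ matrix is $1$. -}

module Defs where

open import Data.Bool using (Bool; true; false; if_then_else_)
open import Data.Nat as ℕ using (ℕ; zero; suc)
open import Data.Fin as Fin using (Fin; zero; suc; toℕ; punchIn; inject₁; fromℕ; cast)
open import Data.Fin.Subset using (Subset; ∣_∣; ∁; inside; outside; _∈_)
open import Data.Fin.Subset.Properties using (∣∁p∣≡n∸∣p∣)
open import Data.Vec using (Vec; []; _∷_; lookup)
open import Data.Rational as ℚ using (ℚ; 0ℚ; 1ℚ; _+_; _*_; _-_; -_)
open import Data.Integer as ℤ using (+_)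
open import Relation.Nullary using (does)
open import Data.Vec using (tabulate)
open import Data.Product using (Σ; _×_; ∃)
open import Data.Empty using (⊥)
open import Function.Definitions using (Injective)
open import Relation.Nullary using (¬_)
open import Relation.Binary.PropositionalEquality using (_≡_; _≢_; cong; sym; trans)
open import Relation.Binary.Construct.Closure.ReflexiveTransitive using (Star)

Matrix : ℕ → ℕ → Set
Matrix m k = Fin m → Fin k → ℚ

Σℚ : ∀ {m} → (Fin m → ℚ) → ℚ
Σℚ {zero}  f = 0ℚ
Σℚ {suc m} f = f zero + Σℚ (λ i → f (suc i))

Σℕ : ∀ {m} → (Fin m → ℕ) → ℕ
Σℕ {zero}  f = 0
Σℕ {suc m} f = f zero ℕ.+ Σℕ (λ i → f (suc i))

_⊗_ : ∀ {a b c} → Matrix a b → Matrix b c → Matrix a c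
(M ⊗ N) i j = Σℚ (λ k → M i k * N k j)

transpose : ∀ {a b} → Matrix a b → Matrix b a
transpose M i j = M j i

natℚ : ℕ → ℚ
natℚ k = (+ k) ℚ./ 1

sgn : ℕ → ℚ
sgn zero          = 1ℚ
sgn (suc zero)    = - 1ℚ
sgn (suc (suc k)) = sgn k

minor : ∀ {m} → Matrix (suc m) (suc m) → Fin (suc m) → Fin (suc m) → Matrix m m
minor M i j a b = M (punchIn i a) (punchIn j b)

det : ∀ {m} → Matrix m m → ℚ
det {zero}  M = 1ℚ
det {suc m} M = Σℚ (λ j → sgn (toℕ j) * (M zero j * det (minor M zero j)))

cofsum : ∀ {m} → Matrix m m → ℚ
cofsum {zero}  B = 0ℚ
cofsum {suc m} B =
  Σℚ (λ i → Σℚ (λ j → sgn (toℕ i ℕ.+ toℕ j) * det (minor B i j)))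

elems : ∀ {n} (p : Subset n) → Fin ∣ p ∣ → Fin n
elems (true  ∷ p) zero    = zero
elems (true  ∷ p) (suc k) = suc (elems p k)
elems (false ∷ p) k       = suc (elems p k)

-- α(Ω): sum of the elements of Ω, vertices labelled 1,…,n
α : ∀ {n} → Subset n → ℕ
α {n} p = Σℕ (λ i → if lookup p i then suc (toℕ i) else 0)

sub : ∀ {n} (W : Matrix n n) (Ω₁ Ω₂ : Subset n) → ∣ Ω₁ ∣ ≡ ∣ Ω₂ ∣ →
      Matrix ∣ Ω₁ ∣ ∣ Ω₁ ∣
sub W Ω₁ Ω₂ eq a b = W (elems Ω₁ a) (elems Ω₂ (cast eq b))

∣∁∣-eq : ∀ {n} (Ω₁ Ω₂ : Subset n) → ∣ Ω₁ ∣ ≡ ∣ Ω₂ ∣ → ∣ ∁ Ω₁ ∣ ≡ ∣ ∁ Ω₂ ∣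
∣∁∣-eq {n} Ω₁ Ω₂ eq =
  trans (∣∁p∣≡n∸∣p∣ Ω₁) (trans (cong (n ℕ.∸_) eq) (sym (∣∁p∣≡n∸∣p∣ Ω₂)))

pair : ∀ {n} → Fin n → Fin n → Subset n
pair {n} i j = tabulate (λ k → if isEq k i then true else isEq k j)
  where
  isEq : Fin n → Fin n → Bool
  isEq a b = does (a Fin.≟ b)

Adj : ℕ → Set
Adj n = Fin n → Fin n → Bool

Edge : ∀ {n} → Adj n → Fin n → Fin n → Set
Edge A i j = A i j ≡ true

b2ℕ : Bool → ℕ
b2ℕ true  = 1
b2ℕ false = 0

outdeg indeg : ∀ {n} → Adj n → Fin n → ℕ
outdeg A i = Σℕ (λ j → b2ℕ (A i j))
indeg  A i = Σℕ (λ j → b2ℕ (A j i))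

Simple : ∀ {n} → Adj n → Set
Simple A = ∀ i → A i i ≡ false

Balanced : ∀ {n} → Adj n → Set
Balanced A = ∀ i → indeg A i ≡ outdeg A i

StronglyConnected : ∀ {n} → Adj n → Set
StronglyConnected A = ∀ i j → Star (Edge A) i j

b2ℚ : Bool → ℚ
b2ℚ true  = 1ℚ
b2ℚ false = 0ℚ

adjMatrix : ∀ {n} → Adj n → Matrix n n
adjMatrix A i j = b2ℚ (A i j)

laplacian : ∀ {n} → Adj n → Matrix n n
laplacian {n} A i j = diag i j - adjMatrix A i j
  where
  diag : Fin n → Fin n → ℚ
  diag a b = if does (a Fin.≟ b) then natℚ (outdeg A a) else 0ℚ

-- X is the Moore–Penrose inverse of M (the four Penrose equations;
-- over ℚ ⊆ ℝ the conjugate transpose is the transpose)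
IsMoorePenrose : ∀ {n} → Matrix n n → Matrix n n → Set
IsMoorePenrose M X =
    (∀ i j → ((M ⊗ X) ⊗ M) i j ≡ M i j)
  × (∀ i j → ((X ⊗ M) ⊗ X) i j ≡ X i j)
  × (∀ i j → transpose (M ⊗ X) i j ≡ (M ⊗ X) i j)
  × (∀ i j → transpose (X ⊗ M) i j ≡ (X ⊗ M) i j)

-- resistance matrix from L†: r_ij = l†_ii + l†_jj - 2 l†_ij
resistance : ∀ {n} → Matrix n n → Matrix n n
resistance Ld i j = (Ld i i + Ld j j) - (natℚ 2 * Ld i j)

-- spanning subgraphs, as n×n boolean arrays (decidable equality)
Subgraph : ℕ → Set
Subgraph n = Vec (Vec Bool n) n

edgeOf : ∀ {n} → Subgraph n → Adj n
edgeOf H i j = lookup (lookup H i) j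

OrientedCycle : ∀ {n} → Adj n → Set
OrientedCycle {n} H =
  Σ ℕ λ m → Σ (Fin (suc m) → Fin n) λ v →
      Injective _≡_ _≡_ v
    × (∀ (t : Fin m) → Edge H (v (inject₁ t)) (v (suc t)))
    × Edge H (v (fromℕ m)) (v zero)

IsOrientedSpanningTree : ∀ {n} → Adj n → Fin n → Subgraph n → Set
IsOrientedSpanningTree A root H =
    (∀ i j → Edge (edgeOf H) i j → Edge A i j)
  × ¬ OrientedCycle (edgeOf H)
  × outdeg (edgeOf H) root ≡ 0
  × (∀ v → v ≢ root → outdeg (edgeOf H) v ≡ 1)

{-# OPTIONS --safe #-}

-- With c = 1/n, the bordered matrices [0 1′; 1 L] and [0 c1′; c1 L†] are
-- inverse to each other, because L L† = I − c11′ (the left kernel of L is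
-- spanned by 1, by the maximum principle) and 1′L† = 0.  Jacobi's formula for
-- complementary minors turns the determinant of [0 c1′; c1 L†[Ω₁,Ω₂]], which is
-- −c² cofsum L†[Ω₁,Ω₂], into a signed minor of L times det [0 c1′; c1 L†]; the
-- case Ω₁ = Ω₂ = {root} evaluates the latter factor, as −c²/κ by the matrix-tree
-- theorem.  Finally R is −2L† up to matrices with constant rows or constant
-- columns, which cofsum ignores.
--
-- The determinant is handled through uniqueness: an alternating function F of
-- the rows of a square matrix is det · F(I).  For the matrix-tree theorem, the
-- rows of L are expanded over the choices of an out-edge at each vertex, and
-- det (I − H) is 1 or 0 as the functional graph H is acyclic or not.
module Submission where

open import Defs
open import Data.Nat using (ℕ; _∸_; _^_)
open import Data.Nat as ℕ using (zero; suc)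
import Data.Nat.Properties as ℕₚ
import Data.Nat.Coprimality as Coprime
import Data.Nat.Solver
open import Data.Nat.Induction using (<-wellFounded)
open import Data.Bool using (Bool; true; false; if_then_else_)
import Data.Bool.Properties as Boolₚ
open import Data.Empty using (⊥-elim)
open import Data.Fin using (Fin; inject₁; fromℕ; cast)
open import Data.Fin as Fin using (zero; suc; toℕ; punchIn; punchOut)
open import Data.Fin.Properties using (punchInᵢ≢i; punchIn-injective; punchIn-punchOut; punchOut-injective; suc-injective; cast-is-id; any?; all?; ¬∀⟶∃¬; pigeonhole; toℕ-inject₁; toℕ-fromℕ; toℕ<n; <-cmp)
open import Data.Fin.Relation.Unary.Top using (view; ‵fromℕ; ‵inject₁)
open import Data.Fin.Subset using (Subset; ∣_∣; ∁; Nonempty; ⊥; ⁅_⁆)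
open import Data.Fin.Subset.Properties using (x∈⁅x⁆; x∈⁅y⁆⇒x≡y)
import Data.Integer as ℤ
import Data.Integer.Properties as ℤₚ
open import Data.List using (List; length; []; _∷_; _++_; map; filter; cartesianProductWith; allFin; tabulate)
open import Data.List.Membership.Propositional using (_∈_)
open import Data.List.Membership.Propositional.Properties
  using (∈-map⁺; ∈-map⁻; ∈-filter⁺; ∈-filter⁻; ∈-allFin; ∈-cartesianProductWith⁺; ∈-cartesianProductWith⁻)
open import Data.List.Membership.Propositional.Properties.WithK using (unique∧set⇒bag)
open import Data.List.Relation.Binary.BagAndSetEquality using (∼bag⇒↭)
open import Data.List.Relation.Binary.Permutation.Propositional.Properties using (↭-length)
open import Data.List.Relation.Unary.All using ([])
open import Data.List.Relation.Unary.AllPairs using ([]; _∷_)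
open import Data.List.Relation.Unary.Any using (here; there)
open import Data.List.Relation.Unary.Unique.Propositional using (Unique)
import Data.List.Relation.Unary.Unique.Propositional.Properties as Uniqueₚ
open import Data.Product using (_×_; _,_; proj₁; proj₂; ∃)
open import Data.Rational using (ℚ; _*_; _+_; 0ℚ; 1ℚ; _-_; -_; mkℚ; _≤_)
open import Data.Rational.Properties as ℚₚ using (+-*-commutativeRing)
open import Data.Sum as Sum using (_⊎_; inj₁; inj₂)
open import Data.Vec using (Vec; []; _∷_; lookup)
open import Data.Vec.Properties using (∷-injective; lookup⇒[]=; []=⇒lookup; lookup-replicate; lookup∘tabulate)
open import Function using (_∘_; id)
open import Function.Bundles using (mk⇔)
open import Function.Definitions using (Injective)
open import Induction.WellFounded using (Acc; acc)
open import Level using (0ℓ)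
open import Relation.Binary.Construct.Closure.ReflexiveTransitive using (Star; ε; _◅_)
open import Relation.Binary.Definitions using (tri<; tri≈; tri>)
open import Relation.Binary.PropositionalEquality using (_≡_; _≢_; refl; sym; trans; cong; cong₂; subst; subst₂; ≢-sym; module ≡-Reasoning; _≗_)
open import Relation.Nullary using (Dec; yes; no; ¬_; does)
open import Relation.Nullary.Decidable using (_×-dec_; dec⇒maybe)
open import Tactic.RingSolver using (solve-∀)
open import Tactic.RingSolver.Core.AlmostCommutativeRing using (AlmostCommutativeRing; fromCommutativeRing)

-- Sums, and alternating functions of the rows of a matrix

-- `det` is defined by expansion along the first row, so its behaviour under changes of the other
-- rows cannot be read off. The detour is `detᵀ`, the expansion along the first column: an induction
-- shows that it alternates in the rows, uniqueness identifies it with `det`, and `det` inherits the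
-- property. There is no division by κ or by c. The number κ stays as a factor on the left, and c is
-- the common entry of I - L L†, known only through n c = 1; cancelling c² means multiplying by n².
-- The labels of the vertices enter only through the sign. The sum of the elements of a subset is a
-- triangular number, fixed by the size, plus the number of increasing pairs (left out, picked),
-- which is the exponent produced by removing rows one at a time. The two subsets have equal size,
-- so the triangular numbers cancel modulo 2. Part (ii) is part (i) for Ω₁ = Ω₂ = {i, j}: the
-- diagonal of R vanishes, so the sum of the four cofactors is -(r_ij + r_ji).

ℚ-ring : AlmostCommutativeRing 0ℓ 0ℓ
ℚ-ring = fromCommutativeRing +-*-commutativeRing (λ x → dec⇒maybe (0ℚ ℚₚ.≟ x))

Vector : ℕ → Set
Vector d = Fin d → ℚ

Σ-cong : ∀ {m} {f g : Vector m} → f ≗ g → Σℚ f ≡ Σℚ g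
Σ-cong {zero}  h = refl
Σ-cong {suc m} h = cong₂ _+_ (h zero) (Σ-cong (h ∘ suc))

Σ-zero : ∀ {m} {f : Vector m} → (∀ i → f i ≡ 0ℚ) → Σℚ f ≡ 0ℚ
Σ-zero {zero}  h = refl
Σ-zero {suc m} h = trans (cong₂ _+_ (h zero) (Σ-zero (h ∘ suc))) (ℚₚ.+-identityˡ 0ℚ)

Σ-linear : ∀ {m} c (f g : Vector m) → Σℚ (λ i → f i + c * g i) ≡ Σℚ f + c * Σℚ g
Σ-linear {zero}  c f g = lemma c
  where
  lemma : ∀ c → 0ℚ ≡ 0ℚ + c * 0ℚ
  lemma = solve-∀ ℚ-ring
Σ-linear {suc m} c f g =
  trans (cong (f zero + c * g zero +_) (Σ-linear c (f ∘ suc) (g ∘ suc)))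
        (lemma c (f zero) (g zero) (Σℚ (f ∘ suc)) (Σℚ (g ∘ suc)))
  where
  lemma : ∀ c x y s t → (x + c * y) + (s + c * t) ≡ (x + s) + c * (y + t)
  lemma = solve-∀ ℚ-ring

Σ-+ : ∀ {m} (f g : Vector m) → Σℚ (λ i → f i + g i) ≡ Σℚ f + Σℚ g
Σ-+ {zero}  f g = sym (ℚₚ.+-identityˡ 0ℚ)
Σ-+ {suc m} f g =
  trans (cong (f zero + g zero +_) (Σ-+ (f ∘ suc) (g ∘ suc)))
        (lemma (f zero) (g zero) (Σℚ (f ∘ suc)) (Σℚ (g ∘ suc)))
  where
  lemma : ∀ x y s t → (x + y) + (s + t) ≡ (x + s) + (y + t)
  lemma = solve-∀ ℚ-ring

Σ-*ˡ : ∀ {m} c (f : Vector m) → Σℚ (λ i → c * f i) ≡ c * Σℚ f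
Σ-*ˡ {zero}  c f = sym (ℚₚ.*-zeroʳ c)
Σ-*ˡ {suc m} c f = trans (cong (c * f zero +_) (Σ-*ˡ c (f ∘ suc))) (sym (ℚₚ.*-distribˡ-+ c _ _))

Σ-*ʳ : ∀ {m} c (f : Vector m) → Σℚ (λ i → f i * c) ≡ Σℚ f * c
Σ-*ʳ c f = trans (Σ-cong (λ i → ℚₚ.*-comm (f i) c)) (trans (Σ-*ˡ c f) (ℚₚ.*-comm c _))

Σ-swap : ∀ {m k} (f : Fin m → Fin k → ℚ) → Σℚ (λ i → Σℚ (f i)) ≡ Σℚ (λ j → Σℚ (λ i → f i j))
Σ-swap {zero} {k} f = sym (Σ-zero {k} (λ _ → refl))
Σ-swap {suc m} f =
  trans (cong (Σℚ (f zero) +_) (Σ-swap (f ∘ suc)))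
        (sym (Σ-+ (f zero) (λ j → Σℚ (λ i → f (suc i) j))))

δ : ∀ {n} → Matrix n n
δ zero    zero    = 1ℚ
δ zero    (suc j) = 0ℚ
δ (suc i) zero    = 0ℚ
δ (suc i) (suc j) = δ i j

δ-diag : ∀ {n} (i : Fin n) → δ i i ≡ 1ℚ
δ-diag zero    = refl
δ-diag (suc i) = δ-diag i

δ-off : ∀ {n} {i j : Fin n} → i ≢ j → δ i j ≡ 0ℚ
δ-off {i = zero}  {zero}  i≢j = ⊥-elim (i≢j refl)
δ-off {i = zero}  {suc j} i≢j = refl
δ-off {i = suc i} {zero}  i≢j = refl
δ-off {i = suc i} {suc j} i≢j = δ-off (i≢j ∘ cong suc)

δ-sym : ∀ {n} (i j : Fin n) → δ i j ≡ δ j i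
δ-sym zero    zero    = refl
δ-sym zero    (suc j) = refl
δ-sym (suc i) zero    = refl
δ-sym (suc i) (suc j) = δ-sym i j

δ-punchIn : ∀ {n} (k : Fin (suc n)) (i j : Fin n) → δ (punchIn k i) (punchIn k j) ≡ δ i j
δ-punchIn zero    i       j       = refl
δ-punchIn (suc k) zero    zero    = refl
δ-punchIn (suc k) zero    (suc j) = refl
δ-punchIn (suc k) (suc i) zero    = refl
δ-punchIn (suc k) (suc i) (suc j) = δ-punchIn k i j

Σ-δˡ : ∀ {n} (i : Fin n) (f : Vector n) → Σℚ (λ k → δ i k * f k) ≡ f i
Σ-δˡ zero    f = trans (cong₂ _+_ (ℚₚ.*-identityˡ (f zero)) (Σ-zero (λ k → ℚₚ.*-zeroˡ (f (suc k)))))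
                       (ℚₚ.+-identityʳ (f zero))
Σ-δˡ (suc i) f = trans (cong₂ _+_ (ℚₚ.*-zeroˡ (f zero)) (Σ-δˡ i (f ∘ suc))) (ℚₚ.+-identityˡ (f (suc i)))

Σ-δʳ : ∀ {n} (i : Fin n) (f : Vector n) → Σℚ (λ k → f k * δ k i) ≡ f i
Σ-δʳ i f = trans (Σ-cong (λ k → trans (ℚₚ.*-comm (f k) _) (cong (_* f k) (δ-sym k i)))) (Σ-δˡ i f)

infixr 5 _∷ᵥ_
_∷ᵥ_ : ∀ {a} {A : Set a} {m} → A → (Fin m → A) → Fin (suc m) → A
(x ∷ᵥ f) zero    = x
(x ∷ᵥ f) (suc i) = f i

sgn-suc : ∀ k → sgn (suc k) ≡ - sgn k
sgn-suc zero          = refl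
sgn-suc (suc zero)    = refl
sgn-suc (suc (suc k)) = sgn-suc k

sgn-+ : ∀ i j → sgn (i ℕ.+ j) ≡ sgn i * sgn j
sgn-+ zero    j = sym (ℚₚ.*-identityˡ (sgn j))
sgn-+ (suc i) j = begin
  sgn (suc (i ℕ.+ j))  ≡⟨ sgn-suc (i ℕ.+ j) ⟩
  - sgn (i ℕ.+ j)      ≡⟨ cong -_ (sgn-+ i j) ⟩
  - (sgn i * sgn j)    ≡⟨ lemma (sgn i) (sgn j) ⟩
  (- sgn i) * sgn j    ≡⟨ cong (_* sgn j) (sym (sgn-suc i)) ⟩
  sgn (suc i) * sgn j  ∎
  where
  open ≡-Reasoning
  lemma : ∀ x y → - (x * y) ≡ (- x) * y
  lemma = solve-∀ ℚ-ring

sgn-square : ∀ k → sgn k * sgn k ≡ 1ℚ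
sgn-square zero          = refl
sgn-square (suc zero)    = refl
sgn-square (suc (suc k)) = sgn-square k

-- Matrices are functions and equality of functions is not extensional, hence `respects`. In
-- `linear` the three matrices are only required to agree off row `i`, which avoids an operation
-- that replaces a row; the single scalar `c` covers additivity and homogeneity together.
record Alternating {m d} (F : Matrix m d → ℚ) : Set where
  field
    respects : ∀ {M P} → (∀ k → M k ≗ P k) → F M ≡ F P
    linear   : ∀ i c {M P Q} → (∀ k → k ≢ i → M k ≗ P k) → (∀ k → k ≢ i → M k ≗ Q k) →
               (∀ j → M i j ≡ P i j + c * Q i j) → F M ≡ F P + c * F Q
    repeated : ∀ {i k} → i ≢ k → ∀ {M} → M i ≗ M k → F M ≡ 0ℚ

open Alternating

fix-first-row : ∀ {m d} {F : Matrix (suc m) d → ℚ} → Alternating F →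
                (v : Vector d) → Alternating (λ B → F (v ∷ᵥ B))
fix-first-row {F = F} alt v = record
  { respects = λ h → respects alt (λ { zero → λ _ → refl ; (suc k) → h k })
  ; linear   = λ i c hP hQ hi → linear alt (suc i) c
                 (λ { zero _ → λ _ → refl ; (suc k) k≢i → hP k (k≢i ∘ cong suc) })
                 (λ { zero _ → λ _ → refl ; (suc k) k≢i → hQ k (k≢i ∘ cong suc) })
                 hi
  ; repeated = λ i≢k h → repeated alt (i≢k ∘ suc-injective) h
  }

-- Only linearity in each row and vanishing when some row is v are used, so
-- the induction may fix the leading rows one after the other.
record VanishingAt {m d} (v : Vector d) (F : Matrix m d → ℚ) : Set where
  field
    respects : ∀ {M P} → (∀ k → M k ≗ P k) → F M ≡ F P
    linear   : ∀ i c {M P Q} → (∀ k → k ≢ i → M k ≗ P k) → (∀ k → k ≢ i → M k ≗ Q k) →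
               (∀ j → M i j ≡ P i j + c * Q i j) → F M ≡ F P + c * F Q
    vanishes : ∀ i {M} → M i ≗ v → F M ≡ 0ℚ

add-multiples : ∀ {m d} {v : Vector d} {F : Matrix m d → ℚ} → VanishingAt v F →
                ∀ (c : Vector m) {M P} → (∀ i j → M i j ≡ P i j + c i * v j) → F M ≡ F P
add-multiples {zero}          V c h = VanishingAt.respects V (λ ())
add-multiples {suc m} {v = v} {F = F} V c {M} {P} h = begin
  F M                                             ≡⟨ V.linear zero (c zero) off off (h zero) ⟩
  F (P zero ∷ᵥ M ∘ suc) + c zero * F (v ∷ᵥ M ∘ suc) ≡⟨ cong (λ x → F (P zero ∷ᵥ M ∘ suc) + c zero * x)
                                                           (V.vanishes zero (λ _ → refl)) ⟩
  F (P zero ∷ᵥ M ∘ suc) + c zero * 0ℚ              ≡⟨ lemma _ (c zero) ⟩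
  F (P zero ∷ᵥ M ∘ suc)                           ≡⟨ add-multiples tailV (c ∘ suc) (λ i → h (suc i)) ⟩
  F (P zero ∷ᵥ P ∘ suc)                           ≡⟨ V.respects (λ { zero → λ _ → refl ; (suc k) → λ _ → refl }) ⟩
  F P                                             ∎
  where
  open ≡-Reasoning
  module V = VanishingAt V
  lemma : ∀ x c → x + c * 0ℚ ≡ x
  lemma = solve-∀ ℚ-ring
  off : ∀ {w : Vector _} k → k ≢ zero → M k ≗ (w ∷ᵥ M ∘ suc) k
  off zero    k≢0 = ⊥-elim (k≢0 refl)
  off (suc k) _   = λ _ → refl
  tailV : VanishingAt v (λ B → F (P zero ∷ᵥ B))
  tailV = record
    { respects = λ h → V.respects (λ { zero → λ _ → refl ; (suc k) → h k })
    ; linear   = λ i c hP hQ hi → V.linear (suc i) c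
                   (λ { zero _ → λ _ → refl ; (suc k) k≢i → hP k (k≢i ∘ cong suc) })
                   (λ { zero _ → λ _ → refl ; (suc k) k≢i → hQ k (k≢i ∘ cong suc) })
                   hi
    ; vanishes = λ i → V.vanishes (suc i)
    }

-- Once `v` is fixed as the first row, a further row equal to `v` is a repetition, so the function
-- of the remaining rows vanishes at `v`.
add-multiples-of-first-row : ∀ {m d} {F : Matrix (suc m) d → ℚ} → Alternating F →
  ∀ (v : Vector d) (c : Vector m) {M P : Matrix m d} →
  (∀ i j → M i j ≡ P i j + c i * v j) → F (v ∷ᵥ M) ≡ F (v ∷ᵥ P)
add-multiples-of-first-row alt v c h = add-multiples V c h
  where
  module G = Alternating (fix-first-row alt v)
  V : VanishingAt v _
  V = record { respects = G.respects ; linear = G.linear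
             ; vanishes = λ i Mi≗v → repeated alt {zero} {suc i} (λ ()) (λ j → sym (Mi≗v j)) }

≡2x⇒≡0 : ∀ {x} → x ≡ x + 1ℚ * x → x ≡ 0ℚ
≡2x⇒≡0 {x} e = trans (cancel x) (trans (cong (_- x) (sym e)) (ℚₚ.+-inverseʳ x))
  where
  cancel : ∀ x → x ≡ (x + 1ℚ * x) - x
  cancel = solve-∀ ℚ-ring

-- A zero row is the sum of itself and itself, so linearity with `c = 1` gives
-- `F M ≡ F M + 1ℚ * F M`.
zero-row : ∀ {m d} {F : Matrix m d → ℚ} → Alternating F →
           ∀ i {M} → (∀ j → M i j ≡ 0ℚ) → F M ≡ 0ℚ
zero-row alt i {M} h = ≡2x⇒≡0 (linear alt i 1ℚ (λ _ _ _ → refl) (λ _ _ _ → refl)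
  (λ j → trans (h j) (sym (cong₂ (λ x y → x + 1ℚ * y) (h j) (h j)))))

record Linear {d} (f : Vector d → ℚ) : Set where
  field
    respects : ∀ {u v} → u ≗ v → f u ≡ f v
    linear   : ∀ c {u v w} → (∀ j → u j ≡ v j + c * w j) → f u ≡ f v + c * f w

linear-0 : ∀ {d} {f : Vector d → ℚ} → Linear f → f (λ _ → 0ℚ) ≡ 0ℚ
linear-0 lin = ≡2x⇒≡0 (Linear.linear lin 1ℚ (λ _ → refl))

linear-basis : ∀ {d} {f : Vector d → ℚ} → Linear f → ∀ v → f v ≡ Σℚ (λ j → v j * f (δ j))
linear-basis {zero}          lin v = trans (Linear.respects lin (λ ())) (linear-0 lin)
linear-basis {suc d} {f = f} lin v = begin
  f v                                              ≡⟨ L.linear (v zero) (λ { zero → l₁ (v zero) ; (suc j) → l₂ (v zero) (v (suc j)) }) ⟩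
  f (0ℚ ∷ᵥ v ∘ suc) + v zero * f (δ zero)          ≡⟨ cong (_+ v zero * f (δ zero)) (linear-basis tailLin (v ∘ suc)) ⟩
  Σℚ (λ j → v (suc j) * f (0ℚ ∷ᵥ δ j)) + v zero * f (δ zero)
                                                   ≡⟨ ℚₚ.+-comm _ (v zero * f (δ zero)) ⟩
  v zero * f (δ zero) + Σℚ (λ j → v (suc j) * f (0ℚ ∷ᵥ δ j))
    ≡⟨ cong (v zero * f (δ zero) +_) (Σ-cong (λ j → cong (v (suc j) *_)
         (L.respects (λ { zero → refl ; (suc k) → refl })))) ⟩
  Σℚ (λ j → v j * f (δ j))                         ∎
  where
  open ≡-Reasoning
  module L = Linear lin
  l₁ : ∀ x → x ≡ 0ℚ + x * 1ℚ
  l₁ = solve-∀ ℚ-ring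
  l₂ : ∀ x y → y ≡ y + x * 0ℚ
  l₂ = solve-∀ ℚ-ring
  l₃ : ∀ c → 0ℚ ≡ 0ℚ + c * 0ℚ
  l₃ = solve-∀ ℚ-ring
  tailLin : Linear (λ u → f (0ℚ ∷ᵥ u))
  tailLin = record
    { respects = λ h → L.respects (λ { zero → refl ; (suc j) → h j })
    ; linear   = λ c h → L.linear c (λ { zero → l₃ c ; (suc j) → h j })
    }

linear-first-row : ∀ {m d} {F : Matrix (suc m) d → ℚ} → Alternating F →
                   (B : Matrix m d) → Linear (λ v → F (v ∷ᵥ B))
linear-first-row alt B = record
  { respects = λ h → respects alt (λ { zero → h ; (suc k) → λ _ → refl })
  ; linear   = λ c h → linear alt zero c off off h
  }
  where
  off : ∀ {u w : Vector _} k → k ≢ zero → (u ∷ᵥ B) k ≗ (w ∷ᵥ B) k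
  off zero    k≢0 = ⊥-elim (k≢0 refl)
  off (suc k) _   = λ _ → refl

-- With w = v + u, the second row may be changed from v to w below u, and from u to w below v,
-- without changing the value. The vanishing value at (w, w) then splits into the values at (v, w)
-- and (u, w), which are therefore opposite.
swap-first-rows : ∀ {m d} {F : Matrix (suc (suc m)) d → ℚ} → Alternating F →
                  ∀ u v B → F (u ∷ᵥ v ∷ᵥ B) ≡ - F (v ∷ᵥ u ∷ᵥ B)
swap-first-rows {F = F} alt u v B = trans (sym u,u+v) (trans u,w (cong -_ v,u+v))
  where
  w : Vector _
  w j = v j + 1ℚ * u j
  add-zero : ∀ x → x + 1ℚ * 0ℚ ≡ x
  add-zero = solve-∀ ℚ-ring
  exchange : ∀ x y → x + 1ℚ * y ≡ y + 1ℚ * x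
  exchange = solve-∀ ℚ-ring
  cancel : ∀ x y → x ≡ (y + 1ℚ * x) - y
  cancel = solve-∀ ℚ-ring
  second : ∀ x → Linear (λ y → F (x ∷ᵥ y ∷ᵥ B))
  second x = linear-first-row (fix-first-row alt x) B
  equal : ∀ x → F (x ∷ᵥ x ∷ᵥ B) ≡ 0ℚ
  equal x = repeated alt {zero} {suc zero} (λ ()) (λ _ → refl)
  u,u+v : F (u ∷ᵥ w ∷ᵥ B) ≡ F (u ∷ᵥ v ∷ᵥ B)
  u,u+v = trans (Linear.linear (second u) 1ℚ (λ _ → refl))
                (trans (cong (λ x → F (u ∷ᵥ v ∷ᵥ B) + 1ℚ * x) (equal u)) (add-zero _))
  v,u+v : F (v ∷ᵥ w ∷ᵥ B) ≡ F (v ∷ᵥ u ∷ᵥ B)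
  v,u+v = trans (Linear.linear (second v) 1ℚ (λ j → exchange (v j) (u j)))
                (trans (cong (λ x → F (v ∷ᵥ u ∷ᵥ B) + 1ℚ * x) (equal v)) (add-zero _))
  w,w : 0ℚ ≡ F (v ∷ᵥ w ∷ᵥ B) + 1ℚ * F (u ∷ᵥ w ∷ᵥ B)
  w,w = trans (sym (equal w)) (Linear.linear (linear-first-row alt (w ∷ᵥ B)) 1ℚ (λ _ → refl))
  u,w : F (u ∷ᵥ w ∷ᵥ B) ≡ - F (v ∷ᵥ w ∷ᵥ B)
  u,w = trans (cancel _ (F (v ∷ᵥ w ∷ᵥ B)))
              (trans (cong (_- F (v ∷ᵥ w ∷ᵥ B)) (sym w,w)) (ℚₚ.+-identityˡ _))

-- One swap brings row zero back to the top; below it the same row still has to travel one place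
-- less, which is the induction hypothesis for `F` with its first row fixed.
move-to-first : ∀ {m d} {F : Matrix (suc m) d → ℚ} → Alternating F →
                ∀ i M → F (M i ∷ᵥ M ∘ punchIn i) ≡ sgn (toℕ i) * F M
move-to-first {F = F} alt zero M =
  trans (respects alt (λ { zero → λ _ → refl ; (suc k) → λ _ → refl })) (sym (ℚₚ.*-identityˡ (F M)))
move-to-first {suc m} {F = F} alt (suc i) M = begin
  F (M (suc i) ∷ᵥ M ∘ punchIn (suc i))
    ≡⟨ respects alt (λ { zero → λ _ → refl ; (suc zero) → λ _ → refl ; (suc (suc k)) → λ _ → refl }) ⟩
  F (M (suc i) ∷ᵥ M zero ∷ᵥ M ∘ suc ∘ punchIn i)
    ≡⟨ swap-first-rows alt (M (suc i)) (M zero) (M ∘ suc ∘ punchIn i) ⟩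
  - F (M zero ∷ᵥ M (suc i) ∷ᵥ M ∘ suc ∘ punchIn i)
    ≡⟨ cong -_ (move-to-first (fix-first-row alt (M zero)) i (M ∘ suc)) ⟩
  - (sgn (toℕ i) * F (M zero ∷ᵥ M ∘ suc))
    ≡⟨ ℚₚ.neg-distribˡ-* (sgn (toℕ i)) _ ⟩
  (- sgn (toℕ i)) * F (M zero ∷ᵥ M ∘ suc)
    ≡⟨ cong₂ _*_ (sym (sgn-suc (toℕ i))) (respects alt (λ { zero → λ _ → refl ; (suc k) → λ _ → refl })) ⟩
  sgn (toℕ (suc i)) * F M ∎
  where open ≡-Reasoning

-- Uniqueness of the determinant among alternating functions

insert-zero : ∀ {d} → Fin (suc d) → Vector d → Vector (suc d)
insert-zero zero            v = 0ℚ ∷ᵥ v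
insert-zero {suc d} (suc j) v = v zero ∷ᵥ insert-zero j (v ∘ suc)

insert-zero-at : ∀ {d} j (v : Vector d) → insert-zero j v j ≡ 0ℚ
insert-zero-at zero            v = refl
insert-zero-at {suc d} (suc j) v = insert-zero-at j (v ∘ suc)

insert-zero-punchIn : ∀ {d} j (v : Vector d) k → insert-zero j v (punchIn j k) ≡ v k
insert-zero-punchIn zero    v k       = refl
insert-zero-punchIn (suc j) v zero    = refl
insert-zero-punchIn (suc j) v (suc k) = insert-zero-punchIn j (v ∘ suc) k

data PunchView {n} (j : Fin (suc n)) : Fin (suc n) → Set where
  hole  : PunchView j j
  other : ∀ k → PunchView j (punchIn j k)

punchView : ∀ {n} (j i : Fin (suc n)) → PunchView j i
punchView j i with j Fin.≟ i
... | yes refl = hole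
... | no j≢i   = subst (PunchView j) (punchIn-punchOut j≢i) (other (punchOut j≢i))

insert-zero-linear : ∀ {d} (j : Fin (suc d)) c {u v w : Vector d} → (∀ k → u k ≡ v k + c * w k) →
                     ∀ i → insert-zero j u i ≡ insert-zero j v i + c * insert-zero j w i
insert-zero-linear j c {u} {v} {w} h i with punchView j i
... | hole    = trans (insert-zero-at j u)
                  (sym (trans (cong₂ (λ x y → x + c * y) (insert-zero-at j v) (insert-zero-at j w)) (lemma c)))
  where
  lemma : ∀ c → 0ℚ + c * 0ℚ ≡ 0ℚ
  lemma = solve-∀ ℚ-ring
... | other k = trans (insert-zero-punchIn j u k) (trans (h k)
                  (sym (cong₂ (λ x y → x + c * y) (insert-zero-punchIn j v k) (insert-zero-punchIn j w k))))

insert-zero-cong : ∀ {d} (j : Fin (suc d)) {u v : Vector d} → u ≗ v → insert-zero j u ≗ insert-zero j v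
insert-zero-cong j {u} {v} h i with punchView j i
... | hole    = trans (insert-zero-at j u) (sym (insert-zero-at j v))
... | other k = trans (insert-zero-punchIn j u k) (trans (h k) (sym (insert-zero-punchIn j v k)))

insert-zero-δ : ∀ {n} (j : Fin (suc n)) k → insert-zero j (δ k) ≗ δ (punchIn j k)
insert-zero-δ j k i with punchView j i
... | hole    = trans (insert-zero-at j (δ k)) (sym (δ-off (punchInᵢ≢i j k)))
... | other l = trans (insert-zero-punchIn j (δ k) l) (sym (δ-punchIn j k l))

-- This is the function to which the induction in `alternating-unique` applies: a minor is put back
-- into a full matrix by a zero column at `j` and the first row `δ j`.
restrict-to-minor : ∀ {m d} {F : Matrix (suc m) (suc d) → ℚ} → Alternating F →
                    ∀ j → Alternating (λ B → F (δ j ∷ᵥ insert-zero j ∘ B))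
restrict-to-minor {F = F} alt j = record
  { respects = λ h → respects G (λ k → insert-zero-cong j (h k))
  ; linear   = λ i c hP hQ hi → linear G i c (λ k k≢i → insert-zero-cong j (hP k k≢i))
                 (λ k k≢i → insert-zero-cong j (hQ k k≢i)) (insert-zero-linear j c hi)
  ; repeated = λ i≢k h → repeated G i≢k (insert-zero-cong j h)
  }
  where
  G : Alternating (λ B → F (δ j ∷ᵥ B))
  G = fix-first-row alt (δ j)

-- Subtracting `B i j` times the first row `δ j` from row `i` kills its entry in column `j` and
-- touches nothing else.
clear-column : ∀ {m d} {F : Matrix (suc m) (suc d) → ℚ} → Alternating F → ∀ j B →
               F (δ j ∷ᵥ B) ≡ F (δ j ∷ᵥ insert-zero j ∘ (λ i k → B i (punchIn j k)))
clear-column alt j B = add-multiples-of-first-row alt (δ j) (λ i → B i j) entry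
  where
  l₁ : ∀ x → x ≡ 0ℚ + x * 1ℚ
  l₁ = solve-∀ ℚ-ring
  l₂ : ∀ x y → y ≡ y + x * 0ℚ
  l₂ = solve-∀ ℚ-ring
  entry : ∀ i k → B i k ≡ insert-zero j (λ l → B i (punchIn j l)) k + B i j * δ j k
  entry i k with punchView j k
  ... | hole    = trans (l₁ (B i j)) (sym (cong₂ (λ x y → x + B i j * y) (insert-zero-at j _) (δ-diag j)))
  ... | other l = trans (l₂ (B i j) _) (sym (cong₂ (λ x y → x + B i j * y) (insert-zero-punchIn j _ l)
                    (δ-off (≢-sym (punchInᵢ≢i j l)))))

-- Linearity in the first row reproduces the recursion that defines `det`, with the minors supplied
-- by `restrict-to-minor`.
alternating-unique : ∀ {m} {F : Matrix m m → ℚ} → Alternating F → ∀ M → F M ≡ det M * F δ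
alternating-unique {zero}  {F} alt M = trans (respects alt (λ ())) (sym (ℚₚ.*-identityˡ (F δ)))
alternating-unique {suc m} {F} alt M = begin
  F M
    ≡⟨ respects alt (λ { zero → λ _ → refl ; (suc k) → λ _ → refl }) ⟩
  F (M zero ∷ᵥ M ∘ suc)
    ≡⟨ linear-basis (linear-first-row alt (M ∘ suc)) (M zero) ⟩
  Σℚ (λ j → M zero j * F (δ j ∷ᵥ M ∘ suc))
    ≡⟨ Σ-cong term ⟩
  Σℚ (λ j → sgn (toℕ j) * (M zero j * det (minor M zero j)) * F δ)
    ≡⟨ Σ-*ʳ (F δ) (λ j → sgn (toℕ j) * (M zero j * det (minor M zero j))) ⟩
  det M * F δ ∎
  where
  open ≡-Reasoning
  rearrange : ∀ a d s f → a * (d * (s * f)) ≡ s * (a * d) * f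
  rearrange = solve-∀ ℚ-ring
  term : ∀ j → M zero j * F (δ j ∷ᵥ M ∘ suc) ≡ sgn (toℕ j) * (M zero j * det (minor M zero j)) * F δ
  term j = begin
    M zero j * F (δ j ∷ᵥ M ∘ suc)
      ≡⟨ cong (M zero j *_) (clear-column alt j (M ∘ suc)) ⟩
    M zero j * F (δ j ∷ᵥ insert-zero j ∘ minor M zero j)
      ≡⟨ cong (M zero j *_) (alternating-unique (restrict-to-minor alt j) (minor M zero j)) ⟩
    M zero j * (det (minor M zero j) * F (δ j ∷ᵥ insert-zero j ∘ δ))
      -- What is left is the identity matrix with row `j` moved to the top, which accounts for the
      -- sign in the expansion.
      ≡⟨ cong (λ x → M zero j * (det (minor M zero j) * x))
           (trans (respects alt (λ { zero → λ _ → refl ; (suc k) → insert-zero-δ j k }))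
                  (move-to-first alt j δ)) ⟩
    M zero j * (det (minor M zero j) * (sgn (toℕ j) * F δ))
      ≡⟨ rearrange (M zero j) (det (minor M zero j)) (sgn (toℕ j)) (F δ) ⟩
    sgn (toℕ j) * (M zero j * det (minor M zero j)) * F δ ∎

-- Determinants

det-cong : ∀ {m} {M P : Matrix m m} → (∀ i → M i ≗ P i) → det M ≡ det P
det-cong {zero}  h = refl
det-cong {suc m} h = Σ-cong (λ j → cong (sgn (toℕ j) *_)
  (cong₂ _*_ (h zero j) (det-cong (λ a b → h (suc a) (punchIn j b)))))

-- Repeated rows are treated first for neighbours: two neighbouring rows remain neighbours when
-- another row is deleted, so the induction on the expansion stays within this relation.
data Consecutive : ∀ {m} → Fin m → Fin m → Set where
  first : ∀ {m} → Consecutive {suc (suc m)} zero (suc zero)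
  next  : ∀ {m} {i k : Fin m} → Consecutive i k → Consecutive (suc i) (suc k)

consecutive-≢ : ∀ {m} {i k : Fin m} → Consecutive i k → i ≢ k
consecutive-≢ (next c) e = consecutive-≢ c (suc-injective e)

consecutive-sgn : ∀ {m} {i k : Fin m} → Consecutive i k → sgn (toℕ k) ≡ - sgn (toℕ i)
consecutive-sgn first            = refl
consecutive-sgn (next {i = i} {k} c) =
  trans (sgn-suc (toℕ k)) (trans (cong -_ (consecutive-sgn c)) (cong -_ (sym (sgn-suc (toℕ i)))))

-- Deleting row `i` and deleting row `k` leave the same list of rows, except for one place where the
-- first list has `k` and the second has `i`. If those two rows are equal, the two minors coincide.
consecutive-punchIn : ∀ {m} {i k : Fin (suc m)} → Consecutive i k →
  ∀ b → punchIn i b ≡ punchIn k b ⊎ (punchIn i b ≡ k × punchIn k b ≡ i)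
consecutive-punchIn first    zero    = inj₂ (refl , refl)
consecutive-punchIn first    (suc b) = inj₁ refl
consecutive-punchIn (next c) zero    = inj₁ refl
consecutive-punchIn (next c) (suc b) with consecutive-punchIn c b
... | inj₁ e         = inj₁ (cong suc e)
... | inj₂ (e₁ , e₂) = inj₂ (cong suc e₁ , cong suc e₂)

data Avoids {m} (i k : Fin (suc m)) : Fin (suc m) → Set where
  at-i  : Avoids i k i
  at-k  : Avoids i k k
  apart : ∀ {j} {i′ k′ : Fin m} → j ≢ i → j ≢ k → Consecutive i′ k′ → punchIn j i′ ≡ i → punchIn j k′ ≡ k → Avoids i k j

consecutive-avoids : ∀ {m} {i k : Fin (suc m)} → Consecutive i k → ∀ j → Avoids i k j
consecutive-avoids first zero          = at-i
consecutive-avoids first (suc zero)    = at-k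
consecutive-avoids (first {suc m}) (suc (suc j)) = apart (λ ()) (λ ()) first refl refl
consecutive-avoids (next c) zero       = apart (λ ()) (λ ()) c refl refl
consecutive-avoids {suc m} (next c) (suc j)    with consecutive-avoids c j
... | at-i  = at-i
... | at-k  = at-k
... | apart p q c′ e₁ e₂ = apart (p ∘ suc-injective) (q ∘ suc-injective) (next c′) (cong suc e₁) (cong suc e₂)

Σ-consecutive : ∀ {m} {i k : Fin m} → Consecutive i k → ∀ (f : Vector m) →
                (∀ j → j ≢ i → j ≢ k → f j ≡ 0ℚ) → f i + f k ≡ 0ℚ → Σℚ f ≡ 0ℚ
Σ-consecutive first f h e =
  trans (cong (λ x → f zero + (f (suc zero) + x)) (Σ-zero (λ j → h (suc (suc j)) (λ ()) (λ ()))))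
        (trans (cong (f zero +_) (ℚₚ.+-identityʳ _)) e)
Σ-consecutive (next c) f h e =
  trans (cong₂ _+_ (h zero (λ ()) (λ ()))
          (Σ-consecutive c (f ∘ suc) (λ j p q → h (suc j) (p ∘ suc-injective) (q ∘ suc-injective)) e))
        (ℚₚ.+-identityˡ 0ℚ)

-- The expansion along the first column: each term contains one entry of one row and a minor of the
-- other rows, so changes of a row can be followed term by term.
detᵀ : ∀ {m} → Matrix m m → ℚ
detᵀ M = det (transpose M)

without : ∀ {m} → Matrix (suc m) (suc m) → Fin (suc m) → Matrix m m
without M j b a = M (punchIn j b) (suc a)

-- In the term that deletes row `i` only the coefficient depends on that row. In every other term
-- only the minor does, where the row reappears at index `i'` and the induction hypothesis applies.
detᵀ-linear : ∀ {m} i c {M P Q : Matrix m m} → (∀ k → k ≢ i → M k ≗ P k) → (∀ k → k ≢ i → M k ≗ Q k) →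
              (∀ j → M i j ≡ P i j + c * Q i j) → detᵀ M ≡ detᵀ P + c * detᵀ Q
detᵀ-linear {suc m} i c {M} {P} {Q} hP hQ hi = trans (Σ-cong term)
  (Σ-linear c (λ j → sgn (toℕ j) * (P j zero * detᵀ (without P j))) (λ j → sgn (toℕ j) * (Q j zero * detᵀ (without Q j))))
  where
  at : ∀ s x y z d → z ≡ x + c * y → s * (z * d) ≡ s * (x * d) + c * (s * (y * d))
  at s x y z d refl = lemma s x y d c
    where
    lemma : ∀ s x y d c → s * ((x + c * y) * d) ≡ s * (x * d) + c * (s * (y * d))
    lemma = solve-∀ ℚ-ring
  off : ∀ s x d e → s * (x * (d + c * e)) ≡ s * (x * d) + c * (s * (x * e))
  off s x d e = lemma s x d e c
    where
    lemma : ∀ s x d e c → s * (x * (d + c * e)) ≡ s * (x * d) + c * (s * (x * e))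
    lemma = solve-∀ ℚ-ring
  term : ∀ j → sgn (toℕ j) * (M j zero * detᵀ (without M j)) ≡
               sgn (toℕ j) * (P j zero * detᵀ (without P j)) + c * (sgn (toℕ j) * (Q j zero * detᵀ (without Q j)))
  term j with punchView i j
  ... | hole = trans (at (sgn (toℕ i)) (P i zero) (Q i zero) (M i zero) (detᵀ (without M i)) (hi zero))
        (cong₂ (λ x y → sgn (toℕ i) * (P i zero * x) + c * (sgn (toℕ i) * (Q i zero * y)))
          (det-cong (λ a b → hP (punchIn i b) (punchInᵢ≢i i b) (suc a)))
          (det-cong (λ a b → hQ (punchIn i b) (punchInᵢ≢i i b) (suc a))))
  ... | other k = trans
        (cong (λ x → sgn (toℕ j') * (M j' zero * x))
          (detᵀ-linear i' c {without M j'} {without P j'} {without Q j'}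
             (λ b b≢i' a → hP (punchIn j' b) (≢i b b≢i') (suc a))
             (λ b b≢i' a → hQ (punchIn j' b) (≢i b b≢i') (suc a))
             (λ a → subst (λ x → M x (suc a) ≡ P x (suc a) + c * Q x (suc a)) (sym i'-eq) (hi (suc a)))))
        (trans (off (sgn (toℕ j')) (M j' zero) _ _)
          (cong₂ (λ x y → sgn (toℕ j') * (x * detᵀ (without P j')) + c * (sgn (toℕ j') * (y * detᵀ (without Q j'))))
             (hP j' (punchInᵢ≢i i k) zero) (hQ j' (punchInᵢ≢i i k) zero)))
    where
    j' = punchIn i k
    i' = punchOut (punchInᵢ≢i i k)
    i'-eq : punchIn j' i' ≡ i
    i'-eq = punchIn-punchOut (punchInᵢ≢i i k)
    ≢i : ∀ b → b ≢ i' → punchIn j' b ≢ i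
    ≢i b b≢i' e = b≢i' (punchIn-injective j' b i' (trans e (sym i'-eq)))

-- Terms deleting a third row vanish by induction. The terms at `i` and `k` have equal coefficients,
-- equal minors and opposite signs.
detᵀ-consecutive : ∀ {m} {i k : Fin m} → Consecutive i k → ∀ {M} → M i ≗ M k → detᵀ M ≡ 0ℚ
detᵀ-consecutive {suc m} {i} {k} c {M} h = Σ-consecutive c _ vanish cancel
  where
  vanish : ∀ j → j ≢ i → j ≢ k → sgn (toℕ j) * (M j zero * detᵀ (without M j)) ≡ 0ℚ
  vanish j j≢i j≢k with consecutive-avoids c j
  ... | at-i = ⊥-elim (j≢i refl)
  ... | at-k = ⊥-elim (j≢k refl)
  ... | apart _ _ c′ e₁ e₂ = trans
        (cong (λ x → sgn (toℕ j) * (M j zero * x))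
          (detᵀ-consecutive c′ {without M j} (λ a → trans (cong (λ x → M x (suc a)) e₁)
            (trans (h (suc a)) (cong (λ x → M x (suc a)) (sym e₂))))))
        (lemma (sgn (toℕ j)) (M j zero))
    where
    lemma : ∀ s x → s * (x * 0ℚ) ≡ 0ℚ
    lemma = solve-∀ ℚ-ring
  same : ∀ b a → without M k b a ≡ without M i b a
  same b a with consecutive-punchIn c b
  ... | inj₁ e         = cong (λ x → M x (suc a)) (sym e)
  ... | inj₂ (e₁ , e₂) = trans (cong (λ x → M x (suc a)) e₂)
                           (trans (h (suc a)) (cong (λ x → M x (suc a)) (sym e₁)))
  cancel : sgn (toℕ i) * (M i zero * detᵀ (without M i)) + sgn (toℕ k) * (M k zero * detᵀ (without M k)) ≡ 0ℚ
  cancel = trans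
    (cong₂ (λ s x → sgn (toℕ i) * (M i zero * detᵀ (without M i)) + s * x) (consecutive-sgn c)
       (cong₂ _*_ (sym (h zero)) (det-cong (λ a b → same b a))))
    (lemma (sgn (toℕ i)) _)
    where
    lemma : ∀ s x → s * x + (- s) * x ≡ 0ℚ
    lemma = solve-∀ ℚ-ring

set-rows : ∀ {m d} → Fin m → Fin m → Matrix m d → Vector d → Vector d → Matrix m d
set-rows i k M u v l with l Fin.≟ i | l Fin.≟ k
... | yes _ | _     = u
... | no _  | yes _ = v
... | no _  | no _  = M l

module _ {m d} (i k : Fin m) (M : Matrix m d) (u v : Vector d) where

  set-rows-i : set-rows i k M u v i ≡ u
  set-rows-i with i Fin.≟ i
  ... | yes _  = refl
  ... | no i≢i = ⊥-elim (i≢i refl)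

  set-rows-k : i ≢ k → set-rows i k M u v k ≡ v
  set-rows-k i≢k with k Fin.≟ i | k Fin.≟ k
  ... | yes k≡i | _      = ⊥-elim (i≢k (sym k≡i))
  ... | no _    | yes _  = refl
  ... | no _    | no k≢k = ⊥-elim (k≢k refl)

  set-rows-off : ∀ {l} → l ≢ i → l ≢ k → set-rows i k M u v l ≡ M l
  set-rows-off {l} l≢i l≢k with l Fin.≟ i | l Fin.≟ k
  ... | yes e | _     = ⊥-elim (l≢i e)
  ... | no _  | yes e = ⊥-elim (l≢k e)
  ... | no _  | no _  = refl

set-rows-agree : ∀ {m d} {i k : Fin m} {M : Matrix m d} {u u′ v v′} l →
                 (l ≡ i → u ≡ u′) → (l ≡ k → v ≡ v′) → set-rows i k M u v l ≡ set-rows i k M u′ v′ l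
set-rows-agree {i = i} {k} l hu hv with l Fin.≟ i | l Fin.≟ k
... | yes e | _     = hu e
... | no _  | yes e = hv e
... | no _  | no _  = refl

≡⇒≗ : ∀ {d} {u v : Vector d} → u ≡ v → u ≗ v
≡⇒≗ refl _ = refl

-- The order on indices as a chain of unit steps; the length of the chain is what the induction in
-- `vanishes-before` runs on.
data Before : ∀ {m} → Fin m → Fin m → Set where
  one  : ∀ {m} {i k : Fin m} → Consecutive i k → Before i k
  step : ∀ {m} {i j k : Fin m} → Consecutive i j → Before j k → Before i k

before-suc : ∀ {m} {i k : Fin m} → Before i k → Before (suc i) (suc k)
before-suc (one c)    = one (next c)
before-suc (step c b) = step (next c) (before-suc b)

zero-before : ∀ {m} (k : Fin m) → Before zero (suc k)
zero-before zero    = one first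
zero-before (suc k) = step first (before-suc (zero-before k))

before-or-after : ∀ {m} {i k : Fin m} → i ≢ k → Before i k ⊎ Before k i
before-or-after {i = zero}  {zero}  i≢k = ⊥-elim (i≢k refl)
before-or-after {i = zero}  {suc k} i≢k = inj₁ (zero-before k)
before-or-after {i = suc i} {zero}  i≢k = inj₂ (zero-before i)
before-or-after {i = suc i} {suc k} i≢k with before-or-after (i≢k ∘ cong suc)
... | inj₁ b = inj₁ (before-suc b)
... | inj₂ b = inj₂ (before-suc b)

consecutive-< : ∀ {m} {i k : Fin m} → Consecutive i k → i Fin.< k
consecutive-< first    = ℕ.s≤s ℕ.z≤n
consecutive-< (next c) = ℕ.s≤s (consecutive-< c)

before-< : ∀ {m} {i k : Fin m} → Before i k → i Fin.< k
before-< (one c)    = consecutive-< c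
before-< (step c b) = ℕₚ.<-trans (consecutive-< c) (before-< b)

<⇒≢ : ∀ {m} {i k : Fin m} → i Fin.< k → i ≢ k
<⇒≢ i<k refl = ℕₚ.<-irrefl refl i<k

module _ {m d} {F : Matrix m d → ℚ}
  (F-respects : ∀ {M P} → (∀ k → M k ≗ P k) → F M ≡ F P)
  (F-linear : ∀ i c {M P Q} → (∀ k → k ≢ i → M k ≗ P k) → (∀ k → k ≢ i → M k ≗ Q k) →
              (∀ j → M i j ≡ P i j + c * Q i j) → F M ≡ F P + c * F Q)
  (F-consecutive : ∀ {i k} → Consecutive i k → ∀ {M} → M i ≗ M k → F M ≡ 0ℚ) where

  private
    set-linear-i : ∀ i k c {M u v w x} → (∀ j → u j ≡ v j + c * w j) →
                   F (set-rows i k M u x) ≡ F (set-rows i k M v x) + c * F (set-rows i k M w x)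
    set-linear-i i k c {M} {u} {v} {w} {x} h = F-linear i c
      (λ l l≢i → ≡⇒≗ (set-rows-agree l (⊥-elim ∘ l≢i) (λ _ → refl)))
      (λ l l≢i → ≡⇒≗ (set-rows-agree l (⊥-elim ∘ l≢i) (λ _ → refl)))
      (λ j → trans (≡⇒≗ (set-rows-i i k M u x) j) (trans (h j) (sym (cong₂ (λ y z → y + c * z)
        (≡⇒≗ (set-rows-i i k M v x) j) (≡⇒≗ (set-rows-i i k M w x) j)))))

    set-linear-k : ∀ i k c {M u v w x} → i ≢ k → (∀ j → u j ≡ v j + c * w j) →
                   F (set-rows i k M x u) ≡ F (set-rows i k M x v) + c * F (set-rows i k M x w)
    set-linear-k i k c {M} {u} {v} {w} {x} i≢k h = F-linear k c
      (λ l l≢k → ≡⇒≗ (set-rows-agree l (λ _ → refl) (⊥-elim ∘ l≢k)))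
      (λ l l≢k → ≡⇒≗ (set-rows-agree l (λ _ → refl) (⊥-elim ∘ l≢k)))
      (λ j → trans (≡⇒≗ (set-rows-k i k M x u i≢k) j) (trans (h j) (sym (cong₂ (λ y z → y + c * z)
        (≡⇒≗ (set-rows-k i k M x v i≢k) j) (≡⇒≗ (set-rows-k i k M x w i≢k) j)))))

    swap-consecutive : ∀ {i k} → Consecutive i k → ∀ M u v →
                       F (set-rows i k M u v) ≡ - F (set-rows i k M v u)
    swap-consecutive {i} {k} c M u v = lemma _ _ (trans (sym (equal w)) expand)
      where
      i≢k : i ≢ k
      i≢k = consecutive-≢ c
      w : Vector d
      w j = u j + 1ℚ * v j
      f : Vector d → Vector d → ℚ
      f x y = F (set-rows i k M x y)
      equal : ∀ x → f x x ≡ 0ℚ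
      equal x = F-consecutive c (λ j → trans (≡⇒≗ (set-rows-i i k M x x) j) (sym (≡⇒≗ (set-rows-k i k M x x i≢k) j)))
      expand : f w w ≡ (0ℚ + 1ℚ * f u v) + 1ℚ * (f v u + 1ℚ * 0ℚ)
      expand = trans (set-linear-i i k 1ℚ (λ _ → refl))
        (cong₂ (λ x y → x + 1ℚ * y)
          (trans (set-linear-k i k 1ℚ i≢k (λ _ → refl)) (cong (_+ 1ℚ * f u v) (equal u)))
          (trans (set-linear-k i k 1ℚ i≢k (λ _ → refl)) (cong (λ x → f v u + 1ℚ * x) (equal v))))
      lemma : ∀ x y → 0ℚ ≡ (0ℚ + 1ℚ * x) + 1ℚ * (y + 1ℚ * 0ℚ) → x ≡ - y
      lemma x y e = trans (l x y) (trans (cong (_- y) (sym e)) (ℚₚ.+-identityˡ (- y)))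
        where
        l : ∀ x y → x ≡ ((0ℚ + 1ℚ * x) + 1ℚ * (y + 1ℚ * 0ℚ)) - y
        l = solve-∀ ℚ-ring

    -- Exchanging row `i` with its neighbour `j` costs a sign and puts a copy of row `k` at `j`,
    -- from where the chain to `k` is one step shorter.
    vanishes-before : ∀ {i k} → Before i k → ∀ M → M i ≗ M k → F M ≡ 0ℚ
    vanishes-before (one c)    M h = F-consecutive c h
    vanishes-before {i} {k} (step {j = j} c b) M h = begin
      F M                              ≡⟨ F-respects (λ l → ≡⇒≗ (restore l)) ⟩
      F (set-rows i j M (M i) (M j))   ≡⟨ swap-consecutive c M (M i) (M j) ⟩
      - F (set-rows i j M (M j) (M i)) ≡⟨ cong -_ (vanishes-before b _ swapped) ⟩
      - 0ℚ                             ≡⟨⟩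
      0ℚ                               ∎
      where
      open ≡-Reasoning
      i<j = consecutive-< c
      j<k = before-< b
      restore : ∀ l → M l ≡ set-rows i j M (M i) (M j) l
      restore l with l Fin.≟ i | l Fin.≟ j
      ... | yes refl | _        = refl
      ... | no _     | yes refl = refl
      ... | no _     | no _     = refl
      swapped : set-rows i j M (M j) (M i) j ≗ set-rows i j M (M j) (M i) k
      swapped x = trans (≡⇒≗ (set-rows-k i j M _ _ (<⇒≢ i<j)) x) (trans (h x)
        (sym (≡⇒≗ (set-rows-off i j M _ _ (≢-sym (<⇒≢ (ℕₚ.<-trans i<j j<k))) (≢-sym (<⇒≢ j<k))) x)))

  alternating-from-consecutive : Alternating F
  alternating-from-consecutive = record
    { respects = F-respects
    ; linear   = F-linear
    ; repeated = λ i≢k {M} h → equal (before-or-after i≢k) M h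
    }
    where
    equal : ∀ {i k} → Before i k ⊎ Before k i → ∀ M → M i ≗ M k → F M ≡ 0ℚ
    equal (inj₁ b) M h = vanishes-before b M h
    equal (inj₂ b) M h = vanishes-before b M (λ j → sym (h j))

detᵀ-alternating : ∀ {m} → Alternating (detᵀ {m})
detᵀ-alternating = alternating-from-consecutive (λ h → det-cong (λ a b → h b a)) detᵀ-linear detᵀ-consecutive

det-δ : ∀ m → det (δ {m}) ≡ 1ℚ
det-δ zero    = refl
det-δ (suc m) = trans (cong₂ _+_ (trans (ℚₚ.*-identityˡ _) (trans (ℚₚ.*-identityˡ (det (δ {m}))) (det-δ m)))
    (Σ-zero {m} (λ j → lemma (sgn (toℕ (suc j))) (det (minor δ zero (suc j))))))
  (ℚₚ.+-identityʳ 1ℚ)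
  where
  lemma : ∀ s x → s * (0ℚ * x) ≡ 0ℚ
  lemma = solve-∀ ℚ-ring

-- Uniqueness applied to `detᵀ`. That `det` itself alternates in the rows is deduced from this lemma
-- afterwards.
det-transpose : ∀ {m} (M : Matrix m m) → det (transpose M) ≡ det M
det-transpose {m} M = trans (alternating-unique detᵀ-alternating M)
  (trans (cong (det M *_) (trans (det-cong (λ i j → δ-sym {m} j i)) (det-δ m))) (ℚₚ.*-identityʳ _))

det-alternating : ∀ {m} → Alternating (det {m})
det-alternating = record
  { respects = det-cong
  ; linear   = λ i c {M} {P} {Q} hP hQ hi → trans (sym (det-transpose M))
                 (trans (linear detᵀ-alternating i c hP hQ hi)
                   (cong₂ (λ x y → x + c * y) (det-transpose P) (det-transpose Q)))
  ; repeated = λ i≢k {M} h → trans (sym (det-transpose M)) (repeated detᵀ-alternating i≢k h)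
  }

-- For fixed `P`, the map from `B` to `det (B ⊗ P)` is alternating in the rows of `B`, and its value
-- at the identity is `det P`.
det-⊗ : ∀ {m} (M P : Matrix m m) → det (M ⊗ P) ≡ det M * det P
det-⊗ M P = trans (alternating-unique product M) (cong (det M *_) (det-cong (λ i j → Σ-δˡ i (λ k → P k j))))
  where
  product : Alternating (λ B → det (B ⊗ P))
  product = record
    { respects = λ h → det-cong (λ i j → Σ-cong (λ k → cong (_* P k j) (h i k)))
    ; linear   = λ i c {M} {A} {B} hP hQ hi → linear det-alternating i c
        (λ l l≢i j → Σ-cong (λ k → cong (_* P k j) (hP l l≢i k)))
        (λ l l≢i j → Σ-cong (λ k → cong (_* P k j) (hQ l l≢i k)))
        (λ j → trans (Σ-cong (λ k → trans (cong (_* P k j) (hi k)) (lemma (A i k) (B i k) c (P k j))))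
                     (Σ-linear c (λ k → A i k * P k j) (λ k → B i k * P k j)))
    ; repeated = λ i≢k h → repeated det-alternating i≢k (λ j → Σ-cong (λ k → cong (_* P k j) (h k)))
    }
    where
    lemma : ∀ a b c p → (a + c * b) * p ≡ a * p + c * (b * p)
    lemma = solve-∀ ℚ-ring

det-unit-first-row : ∀ {m} (M : Matrix (suc m) (suc m)) j → (M zero ≗ δ j) →
                     det M ≡ sgn (toℕ j) * det (minor M zero j)
det-unit-first-row M j h = trans
  (Σ-cong (λ l → trans (cong (λ x → sgn (toℕ l) * (x * det (minor M zero l))) (h l))
                       (lemma (sgn (toℕ l)) (δ j l) (det (minor M zero l)))))
  (Σ-δˡ j (λ l → sgn (toℕ l) * det (minor M zero l)))
  where
  lemma : ∀ s d x → s * (d * x) ≡ d * (s * x)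
  lemma = solve-∀ ℚ-ring

det-unit-row : ∀ {m} (M : Matrix (suc m) (suc m)) i j → (M i ≗ δ j) →
               det M ≡ sgn (toℕ i ℕ.+ toℕ j) * det (minor M i j)
det-unit-row M i j h = begin
  det M
    ≡⟨ sym (ℚₚ.*-identityˡ (det M)) ⟩
  1ℚ * det M
    ≡⟨ cong (_* det M) (sym (sgn-square (toℕ i))) ⟩
  sgn (toℕ i) * sgn (toℕ i) * det M
    ≡⟨ ℚₚ.*-assoc (sgn (toℕ i)) _ _ ⟩
  sgn (toℕ i) * (sgn (toℕ i) * det M)
    ≡⟨ cong (sgn (toℕ i) *_) (sym (move-to-first det-alternating i M)) ⟩
  sgn (toℕ i) * det (M i ∷ᵥ M ∘ punchIn i)
    ≡⟨ cong (sgn (toℕ i) *_) (det-unit-first-row (M i ∷ᵥ M ∘ punchIn i) j h) ⟩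
  sgn (toℕ i) * (sgn (toℕ j) * det (minor M i j))
    ≡⟨ sym (ℚₚ.*-assoc (sgn (toℕ i)) _ _) ⟩
  sgn (toℕ i) * sgn (toℕ j) * det (minor M i j)
    ≡⟨ cong (_* det (minor M i j)) (sym (sgn-+ (toℕ i) (toℕ j))) ⟩
  sgn (toℕ i ℕ.+ toℕ j) * det (minor M i j) ∎
  where open ≡-Reasoning

-- Complementary minors

-- A selection of η of n indices in increasing order, leaving l of them out.
data Selection : ℕ → ℕ → ℕ → Set where
  []   : Selection 0 0 0
  take : ∀ {η l n} → Selection η l n → Selection (suc η) l (suc n)
  skip : ∀ {η l n} → Selection η l n → Selection η (suc l) (suc n)

pick : ∀ {η l n} → Selection η l n → Fin η → Fin n
pick (take s) = zero ∷ᵥ suc ∘ pick s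
pick (skip s) = suc ∘ pick s

complement : ∀ {η l n} → Selection η l n → Selection l η n
complement []       = []
complement (take s) = skip (complement s)
complement (skip s) = take (complement s)

leave : ∀ {η l n} → Selection η l n → Fin l → Fin n
leave s = pick (complement s)

complement-involutive : ∀ {η l n} (s : Selection η l n) → complement (complement s) ≡ s
complement-involutive []       = refl
complement-involutive (take s) = cong take (complement-involutive s)
complement-involutive (skip s) = cong skip (complement-involutive s)

-- The number of pairs (left out, picked) that are in increasing order.
weight : ∀ {η l n} → Selection η l n → ℕ
weight []             = 0
weight (take s)       = weight s
weight (skip {η} s)   = η ℕ.+ weight s

merge : ∀ {η l n} {A : Set} → Selection η l n → (Fin η → A) → (Fin l → A) → Fin n → A
merge []       f g = f
merge (take s) f g = f zero ∷ᵥ merge s (f ∘ suc) g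
merge (skip s) f g = g zero ∷ᵥ merge s f (g ∘ suc)

merge-pick : ∀ {η l n} {A : Set} (s : Selection η l n) (f : Fin η → A) g → merge s f g ∘ pick s ≗ f
merge-pick (take s) f g zero    = refl
merge-pick (take s) f g (suc a) = merge-pick s (f ∘ suc) g a
merge-pick (skip s) f g a       = merge-pick s f (g ∘ suc) a

merge-leave : ∀ {η l n} {A : Set} (s : Selection η l n) f (g : Fin l → A) → merge s f g ∘ leave s ≗ g
merge-leave (take s) f g b       = merge-leave s (f ∘ suc) g b
merge-leave (skip s) f g zero    = refl
merge-leave (skip s) f g (suc b) = merge-leave s f (g ∘ suc) b

-- Removing the selected indices one at a time, each relabelling the rest by
-- punchIn; w is the sum of the positions at which the removals happen.
data Removal : ∀ (η l n : ℕ) → (Fin η → Fin n) → (Fin l → Fin n) → ℕ → Set where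
  done   : ∀ {n p p′} → p′ ≗ id → Removal 0 n n p p′ 0
  remove : ∀ {η l n p p′ v q q′ w} (i : Fin (suc n)) → Removal η l n p p′ v →
           q zero ≡ i → (∀ a → q (suc a) ≡ punchIn i (p a)) → (∀ b → q′ b ≡ punchIn i (p′ b)) →
           w ≡ toℕ i ℕ.+ v → Removal (suc η) l (suc n) q q′ w

-- A left-out index placed in front survives every removal, so each of the `η` removals takes place
-- one position later.
removal-skip : ∀ {η l n p p′ w} → Removal η l n p p′ w →
               Removal η (suc l) (suc n) (suc ∘ p) (zero ∷ᵥ suc ∘ p′) (η ℕ.+ w)
removal-skip (done h) = done (λ { zero → refl ; (suc b) → cong suc (h b) })
removal-skip {suc η} (remove {v = v} i r q₀ q₊ q′ refl) =
  remove (suc i) (removal-skip r) (cong suc q₀) (λ a → cong suc (q₊ a))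
    (λ { zero → refl ; (suc b) → cong suc (q′ b) })
    (solve 3 (λ η i v → con 1 :+ η :+ (i :+ v) := con 1 :+ i :+ (η :+ v)) refl η (toℕ i) v)
  where open Data.Nat.Solver.+-*-Solver

removal : ∀ {η l n} (s : Selection η l n) → Removal η l n (pick s) (leave s) (weight s)
removal []       = done (λ ())
removal (take s) = remove zero (removal s) refl (λ _ → refl) (λ _ → refl) refl
removal (skip s) = removal-skip (removal s)

-- Each unit row is expanded in turn, deleting its row and the column of its 1. The positions of
-- these deletions in the shrinking matrix are the summands of `v` and `w`.
det-unit-rows : ∀ {η l n p p′ v q q′ w} → Removal η l n p p′ v → Removal η l n q q′ w →
                ∀ (Z : Matrix n n) → (∀ a → Z (p a) ≗ δ (q a)) →
                det Z ≡ sgn (v ℕ.+ w) * det (λ a b → Z (p′ a) (q′ b))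
det-unit-rows (done h) (done k) Z _ =
  trans (det-cong (λ a b → sym (cong₂ Z (h a) (k b)))) (sym (ℚₚ.*-identityˡ _))
det-unit-rows {p′ = p′} {v} {q′ = q′} {w}
  (remove {p = p₀} {p₀′} {v₀} i r p0 p₊ pl refl) (remove {p = q₀} {q₀′} {w₀} j s q0 q₊ ql refl) Z unit = begin
  det Z
    ≡⟨ det-unit-row Z i j row ⟩
  sgn (toℕ i ℕ.+ toℕ j) * det (minor Z i j)
    ≡⟨ cong (sgn (toℕ i ℕ.+ toℕ j) *_) (det-unit-rows r s (minor Z i j) unit₀) ⟩
  sgn (toℕ i ℕ.+ toℕ j) * (sgn (v₀ ℕ.+ w₀) * det (λ a b → Z (punchIn i (p₀′ a)) (punchIn j (q₀′ b))))
    ≡⟨ sym (ℚₚ.*-assoc (sgn (toℕ i ℕ.+ toℕ j)) _ _) ⟩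
  sgn (toℕ i ℕ.+ toℕ j) * sgn (v₀ ℕ.+ w₀) * det (λ a b → Z (punchIn i (p₀′ a)) (punchIn j (q₀′ b)))
    ≡⟨ cong₂ _*_ sign (det-cong (λ a b → sym (cong₂ Z (pl a) (ql b)))) ⟩
  sgn (v ℕ.+ w) * det (λ a b → Z (p′ a) (q′ b)) ∎
  where
  open ≡-Reasoning
  row : Z i ≗ δ j
  row k = subst (λ x → Z x k ≡ δ j k) p0 (trans (unit zero k) (cong (λ x → δ x k) q0))
  unit₀ : ∀ a → minor Z i j (p₀ a) ≗ δ (q₀ a)
  unit₀ a k = trans (cong (λ x → Z x (punchIn j k)) (sym (p₊ a)))
    (trans (unit (suc a) (punchIn j k))
      (trans (cong (λ x → δ x (punchIn j k)) (q₊ a)) (δ-punchIn j (q₀ a) k)))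
  sign : sgn (toℕ i ℕ.+ toℕ j) * sgn (v₀ ℕ.+ w₀) ≡ sgn ((toℕ i ℕ.+ v₀) ℕ.+ (toℕ j ℕ.+ w₀))
  sign = trans (sym (sgn-+ (toℕ i ℕ.+ toℕ j) (v₀ ℕ.+ w₀)))
    (cong sgn (solve 4 (λ i j v w → i :+ j :+ (v :+ w) := i :+ v :+ (j :+ w)) refl (toℕ i) (toℕ j) v₀ w₀))
    where open Data.Nat.Solver.+-*-Solver

-- Jacobi's complementary minor formula.  Let Z have rows δ (pick s a) at the
-- indices pick t a and the rows of M elsewhere; then Z N has the rows of N
-- at pick s a, resp. the rows of the identity.  So det Z and det (Z N) are, up
-- to sign, minors of M and of N.
jacobi : ∀ {η l n} (s t : Selection η l n) (M N : Matrix n n) → (∀ i j → (M ⊗ N) i j ≡ δ i j) →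
         det (λ a b → N (pick s a) (pick t b)) ≡
         det N * (sgn (weight s ℕ.+ weight t) * det (λ a b → M (leave t a) (leave s b)))
jacobi s t M N MN = begin
  det (λ a b → N (pick s a) (pick t b))
    ≡⟨ sym det-ZN ⟩
  det (Z ⊗ N)
    ≡⟨ det-⊗ Z N ⟩
  det Z * det N
    ≡⟨ ℚₚ.*-comm (det Z) (det N) ⟩
  det N * det Z
    ≡⟨ cong (det N *_) det-Z ⟩
  det N * (sgn (weight s ℕ.+ weight t) * det (λ a b → M (leave t a) (leave s b))) ∎
  where
  open ≡-Reasoning
  Z : Matrix _ _
  Z = merge t (δ ∘ pick s) (M ∘ leave t)
  Z-pick : ∀ a → Z (pick t a) ≗ δ (pick s a)
  Z-pick a = ≡⇒≗ (merge-pick t (δ ∘ pick s) (M ∘ leave t) a)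
  Z-leave : ∀ b → Z (leave t b) ≗ M (leave t b)
  Z-leave b = ≡⇒≗ (merge-leave t (δ ∘ pick s) (M ∘ leave t) b)
  det-Z : det Z ≡ sgn (weight s ℕ.+ weight t) * det (λ a b → M (leave t a) (leave s b))
  det-Z = trans (det-unit-rows (removal t) (removal s) Z Z-pick)
    (cong₂ _*_ (cong sgn (ℕₚ.+-comm (weight t) (weight s))) (det-cong (λ a b → Z-leave a (leave s b))))
  c : Selection _ _ _
  c = complement t
  det-ZN : det (Z ⊗ N) ≡ det (λ a b → N (pick s a) (pick t b))
  det-ZN = begin
    det (Z ⊗ N)
      -- The unit rows of `Z ⊗ N` stand at the indices left out by `t`, and their 1s lie on the
      -- diagonal, so rows and columns are removed alike and the sign is a square.
      ≡⟨ det-unit-rows (removal c) (removal c) (Z ⊗ N)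
           (λ b k → trans (Σ-cong (λ x → cong (_* N x k) (Z-leave b x))) (MN (leave t b) k)) ⟩
    sgn (weight c ℕ.+ weight c) * det (λ a b → (Z ⊗ N) (leave c a) (leave c b))
      ≡⟨ cong₂ _*_ (trans (sgn-+ (weight c) (weight c)) (sgn-square (weight c)))
           (det-cong (λ a b → cong₂ (Z ⊗ N) (leave-c a) (leave-c b))) ⟩
    1ℚ * det (λ a b → (Z ⊗ N) (pick t a) (pick t b))
      ≡⟨ ℚₚ.*-identityˡ _ ⟩
    det (λ a b → (Z ⊗ N) (pick t a) (pick t b))
      ≡⟨ det-cong (λ a b → trans (Σ-cong (λ x → cong (_* N x (pick t b)) (Z-pick a x)))
           (Σ-δˡ (pick s a) (λ x → N x (pick t b)))) ⟩
    det (λ a b → N (pick s a) (pick t b)) ∎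
    where
    leave-c : ∀ a → leave c a ≡ pick t a
    leave-c a = cong (λ u → pick u a) (complement-involutive t)

-- Subsets as selections, and the exponent of the sign

fromSubset : ∀ {n} (p : Subset n) → Selection ∣ p ∣ ∣ ∁ p ∣ n
fromSubset []          = []
fromSubset (true ∷ p)  = take (fromSubset p)
fromSubset (false ∷ p) = skip (fromSubset p)

pick-fromSubset : ∀ {n} (p : Subset n) → pick (fromSubset p) ≗ elems p
pick-fromSubset (true ∷ p)  zero    = refl
pick-fromSubset (true ∷ p)  (suc a) = cong suc (pick-fromSubset p a)
pick-fromSubset (false ∷ p) a       = cong suc (pick-fromSubset p a)

leave-fromSubset : ∀ {n} (p : Subset n) → leave (fromSubset p) ≗ elems (∁ p)
leave-fromSubset (true ∷ p)  b       = cong suc (leave-fromSubset p b)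
leave-fromSubset (false ∷ p) zero    = refl
leave-fromSubset (false ∷ p) (suc b) = cong suc (leave-fromSubset p b)

triangle : ℕ → ℕ
triangle zero    = 0
triangle (suc k) = suc k ℕ.+ triangle k

Σℕ-suc : ∀ {n} (p : Subset n) (f : Fin n → ℕ) →
         Σℕ (λ i → if lookup p i then suc (f i) else 0) ≡ Σℕ (λ i → if lookup p i then f i else 0) ℕ.+ ∣ p ∣
Σℕ-suc []          f = refl
Σℕ-suc (true ∷ p)  f = trans (cong (λ x → suc (f zero ℕ.+ x)) (Σℕ-suc p (f ∘ suc)))
  (solve 3 (λ x y z → con 1 :+ (x :+ (y :+ z)) := x :+ y :+ (con 1 :+ z)) refl (f zero) _ ∣ p ∣)
  where open Data.Nat.Solver.+-*-Solver
Σℕ-suc (false ∷ p) f = Σℕ-suc p (f ∘ suc)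

-- The a-th smallest element is a plus the number of left-out indices below it. Summing a gives the
-- triangular number, and summing the rest counts the pairs in `weight`. In the induction a new
-- first index raises all later labels by one, which adds the size of `p`.
α-weight : ∀ {n} (p : Subset n) → α p ≡ weight (fromSubset p) ℕ.+ triangle ∣ p ∣
α-weight []          = refl
α-weight (true ∷ p)  = trans (cong suc (trans (Σℕ-suc p (suc ∘ toℕ)) (cong (ℕ._+ ∣ p ∣) (α-weight p))))
  (solve 3 (λ w t e → con 1 :+ (w :+ t :+ e) := w :+ (con 1 :+ e :+ t)) refl
     (weight (fromSubset p)) (triangle ∣ p ∣) ∣ p ∣)
  where open Data.Nat.Solver.+-*-Solver
α-weight (false ∷ p) = trans (trans (Σℕ-suc p (suc ∘ toℕ)) (cong (ℕ._+ ∣ p ∣) (α-weight p)))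
  (solve 3 (λ w t e → w :+ t :+ e := e :+ w :+ t) refl (weight (fromSubset p)) (triangle ∣ p ∣) ∣ p ∣)
  where open Data.Nat.Solver.+-*-Solver

-- Bordered matrices and sums of cofactors

power : ℚ → ℕ → ℚ
power x zero    = 1ℚ
power x (suc k) = x * power x k

det-scale : ∀ {m} x (B : Matrix m m) → det (λ i j → x * B i j) ≡ power x m * det B
det-scale {zero}  x B = refl
det-scale {suc m} x B = trans
  (Σ-cong (λ j → trans (cong (λ d → sgn (toℕ j) * (x * B zero j * d)) (det-scale x (minor B zero j)))
                       (lemma (sgn (toℕ j)) x (B zero j) (power x m) (det (minor B zero j)))))
  (Σ-*ˡ (x * power x m) (λ j → sgn (toℕ j) * (B zero j * det (minor B zero j))))
  where
  lemma : ∀ s x b p d → s * (x * b * (p * d)) ≡ x * p * (s * (b * d))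
  lemma = solve-∀ ℚ-ring

cofsum-cong : ∀ {m} {A B : Matrix m m} → (∀ i → A i ≗ B i) → cofsum A ≡ cofsum B
cofsum-cong {zero}  h = refl
cofsum-cong {suc m} h = Σ-cong (λ i → Σ-cong (λ j → cong (sgn (toℕ i ℕ.+ toℕ j) *_)
  (det-cong (λ a b → h (punchIn i a) (punchIn j b)))))

-- The cofactors of a matrix of order `suc m` are, up to sign, determinants of order `m`; this is
-- the origin of the exponent η - 1.
cofsum-scale : ∀ {m} x (B : Matrix (suc m) (suc m)) → cofsum (λ i j → x * B i j) ≡ power x m * cofsum B
cofsum-scale {m} x B = trans
  (Σ-cong (λ i → trans
    (Σ-cong (λ j → trans (cong (sgn (toℕ i ℕ.+ toℕ j) *_) (det-scale x (minor B i j)))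
                         (lemma (sgn (toℕ i ℕ.+ toℕ j)) (power x m) (det (minor B i j)))))
    (Σ-*ˡ (power x m) (λ j → sgn (toℕ i ℕ.+ toℕ j) * det (minor B i j)))))
  (Σ-*ˡ (power x m) (λ i → Σℚ (λ j → sgn (toℕ i ℕ.+ toℕ j) * det (minor B i j))))
  where
  lemma : ∀ s p d → s * (p * d) ≡ p * (s * d)
  lemma = solve-∀ ℚ-ring

border : ∀ {m} → ℚ → Matrix m m → Matrix (suc m) (suc m)
border c B = (0ℚ ∷ᵥ λ _ → c) ∷ᵥ (λ i → c ∷ᵥ B i)

-- Expanding along the border row and then along the border column visits every cofactor of `B`
-- once, with a factor `c` from each and one extra sign because the border shifts the column index
-- by one.
det-border : ∀ {m} c (B : Matrix m m) → det (border c B) ≡ - (c * c) * cofsum B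
det-border {zero}  c B = sym (ℚₚ.*-zeroʳ (- (c * c)))
det-border {suc m} c B = begin
  det (border c B)
    ≡⟨ drop (det (minor (border c B) zero zero)) (Σℚ second) ⟩
  Σℚ second
    ≡⟨ Σ-cong (λ j → trans (cong (λ x → sgn (suc (toℕ j)) * (c * x)) (first-column j))
         (trans (cong (_* (c * Σℚ (λ i → sgn (toℕ i) * (c * det (minor B i j))))) (sgn-suc (toℕ j)))
         (trans (move₁ (sgn (toℕ j)) c _)
         (trans (cong (_* (- c)) (sym (Σ-*ˡ (sgn (toℕ j)) (λ i → sgn (toℕ i) * (c * det (minor B i j))))))
         (cong (_* (- c)) (trans (Σ-cong (λ i → trans (move₂ (sgn (toℕ j)) (sgn (toℕ i)) c (det (minor B i j)))
              (cong (λ s → c * (s * det (minor B i j))) (sym (sgn-+ (toℕ i) (toℕ j))))))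
           (Σ-*ˡ c (λ i → sgn (toℕ i ℕ.+ toℕ j) * det (minor B i j))))))))) ⟩
  Σℚ (λ j → c * Σℚ (λ i → sgn (toℕ i ℕ.+ toℕ j) * det (minor B i j)) * (- c))
    ≡⟨ Σ-cong (λ j → move₃ c (Σℚ (λ i → sgn (toℕ i ℕ.+ toℕ j) * det (minor B i j)))) ⟩
  Σℚ (λ j → - (c * c) * Σℚ (λ i → sgn (toℕ i ℕ.+ toℕ j) * det (minor B i j)))
    ≡⟨ Σ-*ˡ (- (c * c)) (λ j → Σℚ (λ i → sgn (toℕ i ℕ.+ toℕ j) * det (minor B i j))) ⟩
  - (c * c) * Σℚ (λ j → Σℚ (λ i → sgn (toℕ i ℕ.+ toℕ j) * det (minor B i j)))
    ≡⟨ cong (- (c * c) *_) (sym (Σ-swap (λ i j → sgn (toℕ i ℕ.+ toℕ j) * det (minor B i j)))) ⟩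
  - (c * c) * cofsum B ∎
  where
  open ≡-Reasoning
  second : Vector (suc m)
  second j = sgn (suc (toℕ j)) * (c * det (minor (border c B) zero (suc j)))
  drop : ∀ x y → 1ℚ * (0ℚ * x) + y ≡ y
  drop = solve-∀ ℚ-ring
  move₁ : ∀ s c x → (- s) * (c * x) ≡ (s * x) * (- c)
  move₁ = solve-∀ ℚ-ring
  move₂ : ∀ s t c x → s * (t * (c * x)) ≡ c * ((t * s) * x)
  move₂ = solve-∀ ℚ-ring
  move₃ : ∀ c x → c * x * (- c) ≡ - (c * c) * x
  move₃ = solve-∀ ℚ-ring
  first-column : ∀ j → det (minor (border c B) zero (suc j)) ≡ Σℚ (λ i → sgn (toℕ i) * (c * det (minor B i j)))
  first-column j = trans (sym (det-transpose (minor (border c B) zero (suc j))))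
    (Σ-cong (λ i → cong (λ x → sgn (toℕ i) * (c * x)) (det-transpose (minor B i j))))

cofsum-transpose : ∀ {m} (B : Matrix m m) → cofsum (transpose B) ≡ cofsum B
cofsum-transpose {zero}  B = refl
cofsum-transpose {suc m} B = trans
  (Σ-cong (λ i → Σ-cong (λ j → cong₂ _*_ (cong sgn (ℕₚ.+-comm (toℕ i) (toℕ j))) (det-transpose (minor B j i)))))
  (Σ-swap (λ i j → sgn (toℕ j ℕ.+ toℕ i) * det (minor B j i)))

-- In `border 1ℚ B` the first row is (0, 1, ..., 1). Adding `x i` times it to the row of index
-- `suc i` adds `x i` throughout row `i` of `B`, leaves the border column alone and preserves the
-- determinant.
cofsum-add-rows : ∀ {m} (x : Vector m) (B : Matrix m m) → cofsum (λ i j → B i j + x i) ≡ cofsum B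
cofsum-add-rows x B = cancel _ _ (trans (sym (det-border 1ℚ (λ i j → B i j + x i))) (trans
  (add-multiples-of-first-row det-alternating (0ℚ ∷ᵥ λ _ → 1ℚ) x
    {λ i → 1ℚ ∷ᵥ λ j → B i j + x i} {λ i → 1ℚ ∷ᵥ B i}
    (λ { i zero → l₁ (x i) ; i (suc j) → l₂ (B i j) (x i) }))
  (det-border 1ℚ B)))
  where
  l₁ : ∀ x → 1ℚ ≡ 1ℚ + x * 0ℚ
  l₁ = solve-∀ ℚ-ring
  l₂ : ∀ b x → b + x ≡ b + x * 1ℚ
  l₂ = solve-∀ ℚ-ring
  negate : ∀ x → x ≡ - (- (1ℚ * 1ℚ) * x)
  negate = solve-∀ ℚ-ring
  cancel : ∀ x y → - (1ℚ * 1ℚ) * x ≡ - (1ℚ * 1ℚ) * y → x ≡ y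
  cancel x y e = trans (negate x) (trans (cong -_ e) (sym (negate y)))

cofsum-add-columns : ∀ {m} (y : Vector m) (B : Matrix m m) → cofsum (λ i j → B i j + y j) ≡ cofsum B
cofsum-add-columns y B = trans (sym (cofsum-transpose (λ i j → B i j + y j)))
  (trans (cofsum-add-rows y (transpose B)) (cofsum-transpose B))

cofsum-resistance : ∀ {n m} (K : Matrix n n) (p q : Fin (suc m) → Fin n) →
  cofsum (λ a b → resistance K (p a) (q b)) ≡ power (- natℚ 2) m * cofsum (λ a b → K (p a) (q b))
cofsum-resistance {m = m} K p q = begin
  cofsum (λ a b → resistance K (p a) (q b))
    ≡⟨ cofsum-cong (λ a b → split (K (p a) (p a)) (K (q b) (q b)) (natℚ 2) (K (p a) (q b))) ⟩
  cofsum (λ a b → (- natℚ 2 * K (p a) (q b) + K (q b) (q b)) + K (p a) (p a))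
    ≡⟨ cofsum-add-rows (λ a → K (p a) (p a)) (λ a b → - natℚ 2 * K (p a) (q b) + K (q b) (q b)) ⟩
  cofsum (λ a b → - natℚ 2 * K (p a) (q b) + K (q b) (q b))
    ≡⟨ cofsum-add-columns (λ b → K (q b) (q b)) (λ a b → - natℚ 2 * K (p a) (q b)) ⟩
  cofsum (λ a b → - natℚ 2 * K (p a) (q b))
    ≡⟨ cofsum-scale (- natℚ 2) (λ a b → K (p a) (q b)) ⟩
  power (- natℚ 2) m * cofsum (λ a b → K (p a) (q b)) ∎
  where
  open ≡-Reasoning
  split : ∀ x y t k → (x + y) - (t * k) ≡ (- t * k + y) + x
  split = solve-∀ ℚ-ring

none : ∀ n → Selection 0 n n
none zero    = []
none (suc n) = skip (none n)

leave-none : ∀ n b → leave (none n) b ≡ b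
leave-none (suc n) zero    = refl
leave-none (suc n) (suc b) = cong suc (leave-none n b)

single : ∀ {m} → Fin (suc m) → Selection 1 m (suc m)
single             zero    = take (none _)
single {suc m}     (suc r) = skip (single r)

leave-single : ∀ {m} (r : Fin (suc m)) b → leave (single r) b ≡ punchIn r b
leave-single         zero    b       = cong suc (leave-none _ b)
leave-single {suc m} (suc r) zero    = refl
leave-single {suc m} (suc r) (suc b) = cong suc (leave-single r b)

module _ {m} {L K : Matrix (suc m) (suc m)} {c : ℚ}
  (row-sum    : ∀ i → Σℚ (L i) ≡ 0ℚ)
  (column-sum : ∀ j → Σℚ (λ i → K i j) ≡ 0ℚ)
  (L⊗K        : ∀ i j → (L ⊗ K) i j + c ≡ δ i j)
  (Σc         : Σℚ {suc m} (λ _ → c) ≡ 1ℚ) where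

  -- The four blocks of the product are 1′(c1) = 1, 1′K = 0, L(c1) = 0 and c11′ + LK = I.
  border-inverse : ∀ i j → (border 1ℚ L ⊗ border c K) i j ≡ δ i j
  border-inverse zero    zero    = trans (ℚₚ.+-identityˡ (Σℚ (λ (_ : Fin (suc m)) → 1ℚ * c)))
    (trans (Σ-cong {suc m} (λ _ → ℚₚ.*-identityˡ c)) Σc)
  border-inverse zero    (suc j) = trans (cong₂ _+_ (ℚₚ.*-zeroˡ c) (trans (Σ-cong (λ k → ℚₚ.*-identityˡ (K k j))) (column-sum j)))
    (ℚₚ.+-identityˡ 0ℚ)
  border-inverse (suc i) zero    = trans (cong₂ _+_ (ℚₚ.*-identityˡ 0ℚ) (trans (Σ-*ʳ c (L i)) (trans (cong (_* c) (row-sum i)) (ℚₚ.*-zeroˡ c))))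
    (ℚₚ.+-identityˡ 0ℚ)
  border-inverse (suc i) (suc j) = trans (cong (_+ (L ⊗ K) i j) (ℚₚ.*-identityˡ c)) (trans (ℚₚ.+-comm c _) (L⊗K i j))

  -- Prefixing `take` makes the border row and column part of the picked minor. The complementary
  -- minor then lies inside `L`, and the weights do not change, since the new first index is not
  -- left out.
  bordered-minor : ∀ {η l} (s t : Selection η l (suc m)) →
    - (c * c) * cofsum (λ a b → K (pick s a) (pick t b)) ≡
    det (border c K) * (sgn (weight s ℕ.+ weight t) * det (λ a b → L (leave t a) (leave s b)))
  bordered-minor s t = trans (sym (det-border c (λ a b → K (pick s a) (pick t b))))
    (trans (det-cong corner) (jacobi (take s) (take t) (border 1ℚ L) (border c K) border-inverse))
    where
    corner : ∀ a b → border c (λ a b → K (pick s a) (pick t b)) a b ≡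
                     border c K (pick (take s) a) (pick (take t) b)
    corner zero    zero    = refl
    corner zero    (suc b) = refl
    corner (suc a) zero    = refl
    corner (suc a) (suc b) = refl

  -- The case s = t = single r evaluates det (border c K) in terms of the
  -- principal minor of L at r.
  cofsum-inverse : ∀ r {η l} (s t : Selection η l (suc m)) →
    det (minor L r r) * cofsum (λ a b → K (pick s a) (pick t b)) ≡
    sgn (weight s ℕ.+ weight t) * det (λ a b → L (leave t a) (leave s b))
  cofsum-inverse r s t = begin
    κ * C                                ≡⟨ intro ⟩
    ω * ω * (c * c) * (κ * C)            ≡⟨ l₁ (ω * ω) (c * c) κ C ⟩
    - (ω * ω) * κ * (- (c * c) * C)      ≡⟨ cong (- (ω * ω) * κ *_) (bordered-minor s t) ⟩
    - (ω * ω) * κ * (D * S)              ≡⟨ l₂ (ω * ω) κ D S ⟩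
    - (ω * ω) * (D * (1ℚ * κ)) * S       ≡⟨ cong (λ x → - (ω * ω) * x * S) (sym at-root) ⟩
    - (ω * ω) * (- (c * c) * (1ℚ * 1ℚ + 0ℚ + 0ℚ)) * S ≡⟨ l₃ (ω * ω) (c * c) S ⟩
    ω * ω * (c * c) * S                  ≡⟨ cong (_* S) ω²c² ⟩
    1ℚ * S                               ≡⟨ ℚₚ.*-identityˡ S ⟩
    S                                    ∎
    where
    open ≡-Reasoning
    κ C D S ω : ℚ
    κ = det (minor L r r)
    C = cofsum (λ a b → K (pick s a) (pick t b))
    D = det (border c K)
    S = sgn (weight s ℕ.+ weight t) * det (λ a b → L (leave t a) (leave s b))
    -- The number of vertices as a rational. Since ω c = 1, multiplication by ω² takes the place of
    -- division by c².
    ω = Σℚ {suc m} (λ _ → 1ℚ)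
    l₁ : ∀ w c κ C → w * c * (κ * C) ≡ - w * κ * (- c * C)
    l₁ = solve-∀ ℚ-ring
    l₂ : ∀ w κ D S → - w * κ * (D * S) ≡ - w * (D * (1ℚ * κ)) * S
    l₂ = solve-∀ ℚ-ring
    l₃ : ∀ w c S → - w * (- c * (1ℚ * 1ℚ + 0ℚ + 0ℚ)) * S ≡ w * c * S
    l₃ = solve-∀ ℚ-ring
    l₄ : ∀ w c → w * w * (c * c) ≡ (w * c) * (w * c)
    l₄ = solve-∀ ℚ-ring
    ωc : ω * c ≡ 1ℚ
    ωc = trans (sym (Σ-*ʳ {suc m} c (λ _ → 1ℚ))) (trans (Σ-cong {suc m} (λ _ → ℚₚ.*-identityˡ c)) Σc)
    ω²c² : ω * ω * (c * c) ≡ 1ℚ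
    ω²c² = trans (l₄ ω c) (cong₂ _*_ ωc ωc)
    intro : κ * C ≡ ω * ω * (c * c) * (κ * C)
    intro = trans (sym (ℚₚ.*-identityˡ (κ * C))) (cong (_* (κ * C)) (sym ω²c²))
    w : ℕ
    w = weight (single r)
    -- The bracket is what the cofactor sum of a 1×1 matrix unfolds to, namely 1; on the right `1ℚ`
    -- is the sign of an even exponent.
    at-root : - (c * c) * (1ℚ * 1ℚ + 0ℚ + 0ℚ) ≡ D * (1ℚ * κ)
    at-root = trans (bordered-minor (single r) (single r)) (cong (D *_) (cong₂ _*_
      (trans (sgn-+ w w) (sgn-square w))
      (det-cong (λ a b → cong₂ L (leave-single r a) (leave-single r b)))))

-- The Laplacian and its pseudoinverse

-- `natℚ k` divides by a gcd and does not compute for a variable `k`. The explicit fraction does, so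
-- that addition of rationals unfolds in `natℚ-+`.
natℚ-mkℚ : ∀ k → natℚ k ≡ mkℚ (ℤ.+ k) 0 (Coprime.sym (Coprime.1-coprimeTo k))
natℚ-mkℚ k = ℚₚ.↥p/↧p≡p (mkℚ (ℤ.+ k) 0 (Coprime.sym (Coprime.1-coprimeTo k)))

natℚ-+ : ∀ a b → natℚ (a ℕ.+ b) ≡ natℚ a + natℚ b
natℚ-+ a b = sym (trans (cong₂ _+_ (natℚ-mkℚ a) (natℚ-mkℚ b))
  (ℚₚ./-cong (cong₂ ℤ._+_ (ℤₚ.*-identityʳ (ℤ.+ a)) (ℤₚ.*-identityʳ (ℤ.+ b))) refl))

b2ℚ-natℚ : ∀ b → natℚ (b2ℕ b) ≡ b2ℚ b
b2ℚ-natℚ true  = refl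
b2ℚ-natℚ false = refl

natℚ-Σ : ∀ {n} (f : Fin n → Bool) → natℚ (Σℕ (b2ℕ ∘ f)) ≡ Σℚ (b2ℚ ∘ f)
natℚ-Σ {zero}  f = refl
natℚ-Σ {suc n} f = trans (natℚ-+ (b2ℕ (f zero)) _) (cong₂ _+_ (b2ℚ-natℚ (f zero)) (natℚ-Σ (f ∘ suc)))

laplacian-entry : ∀ {n} (A : Adj n) i j →
                  laplacian A i j ≡ Σℚ (b2ℚ ∘ A i) * δ i j - b2ℚ (A i j)
laplacian-entry A i j = cong (_- b2ℚ (A i j)) diagonal
  where
  diagonal : (if does (i Fin.≟ j) then natℚ (outdeg A i) else 0ℚ) ≡ Σℚ (b2ℚ ∘ A i) * δ i j
  diagonal with i Fin.≟ j
  ... | yes refl = trans (natℚ-Σ (A i)) (sym (trans (cong (Σℚ (b2ℚ ∘ A i) *_) (δ-diag i)) (ℚₚ.*-identityʳ _)))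
  ... | no i≢j   = sym (trans (cong (Σℚ (b2ℚ ∘ A i) *_) (δ-off i≢j)) (ℚₚ.*-zeroʳ (Σℚ (b2ℚ ∘ A i))))

Σ-minus : ∀ {m} (f g : Vector m) → Σℚ (λ i → f i - g i) ≡ Σℚ f - Σℚ g
Σ-minus f g = trans (Σ-cong (λ i → lemma (f i) (g i))) (trans (Σ-linear (- 1ℚ) f g) (sym (lemma (Σℚ f) (Σℚ g))))
  where
  lemma : ∀ x y → x - y ≡ x + (- 1ℚ) * y
  lemma = solve-∀ ℚ-ring

laplacian-row-sum : ∀ {n} (A : Adj n) i → Σℚ (laplacian A i) ≡ 0ℚ
laplacian-row-sum A i = begin
  Σℚ (laplacian A i)
    ≡⟨ Σ-cong (laplacian-entry A i) ⟩
  Σℚ (λ j → Σℚ (b2ℚ ∘ A i) * δ i j - b2ℚ (A i j))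
    ≡⟨ Σ-minus (λ j → Σℚ (b2ℚ ∘ A i) * δ i j) (b2ℚ ∘ A i) ⟩
  Σℚ (λ j → Σℚ (b2ℚ ∘ A i) * δ i j) - Σℚ (b2ℚ ∘ A i)
    ≡⟨ cong (_- Σℚ (b2ℚ ∘ A i)) (trans (Σ-cong (λ j → ℚₚ.*-comm (Σℚ (b2ℚ ∘ A i)) (δ i j)))
         (Σ-δˡ i (λ _ → Σℚ (b2ℚ ∘ A i)))) ⟩
  Σℚ (b2ℚ ∘ A i) - Σℚ (b2ℚ ∘ A i)
    ≡⟨ ℚₚ.+-inverseʳ (Σℚ (b2ℚ ∘ A i)) ⟩
  0ℚ ∎
  where open ≡-Reasoning

balanced-degree : ∀ {n} (A : Adj n) → Balanced A → ∀ j → Σℚ (b2ℚ ∘ A j) ≡ Σℚ (λ i → b2ℚ (A i j))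
balanced-degree A balanced j = trans (sym (natℚ-Σ (A j)))
  (trans (cong natℚ (sym (balanced j))) (natℚ-Σ (λ i → A i j)))

-- Balance replaces the outdegree on the diagonal by the column sum of the adjacency matrix, so each
-- edge i → j into `j` contributes the difference y_j - y_i.
laplacian-left : ∀ {n} (A : Adj n) → Balanced A → ∀ (y : Vector n) j →
                 Σℚ (λ i → y i * laplacian A i j) ≡ Σℚ (λ i → b2ℚ (A i j) * (y j - y i))
laplacian-left A balanced y j = begin
  Σℚ (λ i → y i * laplacian A i j)
    ≡⟨ Σ-cong (λ i → trans (cong (y i *_) (laplacian-entry A i j))
         (distribute (y i) (Σℚ (b2ℚ ∘ A i)) (δ i j) (b2ℚ (A i j)))) ⟩
  Σℚ (λ i → y i * Σℚ (b2ℚ ∘ A i) * δ i j - b2ℚ (A i j) * y i)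
    ≡⟨ Σ-minus (λ i → y i * Σℚ (b2ℚ ∘ A i) * δ i j) (λ i → b2ℚ (A i j) * y i) ⟩
  Σℚ (λ i → y i * Σℚ (b2ℚ ∘ A i) * δ i j) - Σℚ (λ i → b2ℚ (A i j) * y i)
    ≡⟨ cong (_- Σℚ (λ i → b2ℚ (A i j) * y i)) (trans (Σ-δʳ j (λ i → y i * Σℚ (b2ℚ ∘ A i)))
         (trans (cong (y j *_) (balanced-degree A balanced j))
           (trans (ℚₚ.*-comm (y j) (Σℚ (λ i → b2ℚ (A i j)))) (sym (Σ-*ʳ (y j) (λ i → b2ℚ (A i j))))))) ⟩
  Σℚ (λ i → b2ℚ (A i j) * y j) - Σℚ (λ i → b2ℚ (A i j) * y i)
    ≡⟨ sym (Σ-minus (λ i → b2ℚ (A i j) * y j) (λ i → b2ℚ (A i j) * y i)) ⟩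
  Σℚ (λ i → b2ℚ (A i j) * y j - b2ℚ (A i j) * y i)
    ≡⟨ Σ-cong (λ i → factor (b2ℚ (A i j)) (y j) (y i)) ⟩
  Σℚ (λ i → b2ℚ (A i j) * (y j - y i)) ∎
  where
  open ≡-Reasoning
  distribute : ∀ y d e a → y * (d * e - a) ≡ y * d * e - a * y
  distribute = solve-∀ ℚ-ring
  factor : ∀ a x y → a * x - a * y ≡ a * (x - y)
  factor = solve-∀ ℚ-ring

laplacian-column-sum : ∀ {n} (A : Adj n) → Balanced A → ∀ j → Σℚ (λ i → laplacian A i j) ≡ 0ℚ
laplacian-column-sum A balanced j = trans (Σ-cong (λ i → sym (ℚₚ.*-identityˡ (laplacian A i j))))
  (trans (laplacian-left A balanced (λ _ → 1ℚ) j)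
    (Σ-zero (λ i → trans (cong (b2ℚ (A i j) *_) (ℚₚ.+-inverseʳ 1ℚ)) (ℚₚ.*-zeroʳ (b2ℚ (A i j))))))

Σ-nonneg : ∀ {m} {f : Vector m} → (∀ i → 0ℚ ≤ f i) → 0ℚ ≤ Σℚ f
Σ-nonneg {zero}  h = ℚₚ.≤-refl
Σ-nonneg {suc m} h = ℚₚ.+-mono-≤ (h zero) (Σ-nonneg (h ∘ suc))

nonneg-summand-zero : ∀ {x y} → 0ℚ ≤ x → 0ℚ ≤ y → x + y ≡ 0ℚ → x ≡ 0ℚ
nonneg-summand-zero {x} {y} 0≤x 0≤y e = ℚₚ.≤-antisym
  (subst (x ≤_) e (subst (_≤ x + y) (ℚₚ.+-identityʳ x) (ℚₚ.+-monoʳ-≤ x 0≤y))) 0≤x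

Σ-nonneg-zero : ∀ {m} {f : Vector m} → (∀ i → 0ℚ ≤ f i) → Σℚ f ≡ 0ℚ → ∀ i → f i ≡ 0ℚ
Σ-nonneg-zero {f = f} h e zero    = nonneg-summand-zero (h zero) (Σ-nonneg (h ∘ suc)) e
Σ-nonneg-zero {f = f} h e (suc i) = Σ-nonneg-zero (h ∘ suc)
  (nonneg-summand-zero (Σ-nonneg (h ∘ suc)) (h zero) (trans (ℚₚ.+-comm (Σℚ (f ∘ suc)) (f zero)) e)) i

argmax : ∀ {m} (f : Vector (suc m)) → ∃ λ r → ∀ i → f i ≤ f r
argmax {zero}  f = zero , λ { zero → ℚₚ.≤-refl }
argmax {suc m} f with argmax (f ∘ suc)
... | r , max with ℚₚ.≤-total (f zero) (f (suc r))
...   | inj₁ 0≤r = suc r , λ { zero → 0≤r ; (suc i) → max i }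
...   | inj₂ r≤0 = zero , λ { zero → ℚₚ.≤-refl ; (suc i) → ℚₚ.≤-trans (max i) r≤0 }

≤⇒0≤- : ∀ {x y} → x ≤ y → 0ℚ ≤ y - x
≤⇒0≤- {x} {y} x≤y = subst (_≤ y - x) (ℚₚ.+-inverseʳ x) (ℚₚ.+-monoˡ-≤ (- x) x≤y)

-- Maximum principle: the maximum of y spreads backwards along the edges.
laplacian-left-kernel : ∀ {m} (A : Adj (suc m)) → StronglyConnected A → Balanced A →
  ∀ (y : Vector (suc m)) → (∀ j → Σℚ (λ i → y i * laplacian A i j) ≡ 0ℚ) → ∀ i j → y i ≡ y j
laplacian-left-kernel A connected balanced y ker i j with argmax y
... | r , max = trans (spread (connected i r)) (sym (spread (connected j r)))
  where
  along-edge : ∀ {i j} → Edge A i j → y j ≡ y r → y i ≡ y j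
  along-edge {i} {j} e yj≡yr = trans (cancel (y i) (y j)) (trans (cong (λ x → y j - x) difference) (ℚₚ.+-identityʳ (y j)))
    where
    cancel : ∀ x y → x ≡ y - 1ℚ * (y - x)
    cancel = solve-∀ ℚ-ring
    nonneg : ∀ k → 0ℚ ≤ b2ℚ (A k j) * (y j - y k)
    nonneg k with A k j
    ... | true  = subst (0ℚ ≤_) (sym (ℚₚ.*-identityˡ (y j - y k))) (≤⇒0≤- (subst (y k ≤_) (sym yj≡yr) (max k)))
    ... | false = ℚₚ.≤-reflexive (sym (ℚₚ.*-zeroˡ (y j - y k)))
    -- At a vertex `j` where `y` is maximal all summands of `laplacian-left` are non-negative and
    -- their sum is 0, so each vanishes; the edge from `i` to `j` makes the coefficient 1.
    difference : 1ℚ * (y j - y i) ≡ 0ℚ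
    difference = subst (λ b → b2ℚ b * (y j - y i) ≡ 0ℚ) e
      (Σ-nonneg-zero nonneg (trans (sym (laplacian-left A balanced y j)) (ker j)) i)
  spread : ∀ {i} → Star (Edge A) i r → y i ≡ y r
  spread ε        = refl
  spread (e ◅ es) = trans (along-edge e (spread es)) (spread es)

-- The Moore-Penrose inverse of the Laplacian

⊗-column-sum : ∀ {a b c} (M : Matrix a b) (N : Matrix b c) → (∀ k → Σℚ (λ i → M i k) ≡ 0ℚ) →
               ∀ j → Σℚ (λ i → (M ⊗ N) i j) ≡ 0ℚ
⊗-column-sum M N h j = trans (Σ-swap (λ i k → M i k * N k j))
  (Σ-zero (λ k → trans (Σ-*ʳ (N k j) (λ i → M i k)) (trans (cong (_* N k j) (h k)) (ℚₚ.*-zeroˡ (N k j)))))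

⊗-row-sum : ∀ {a b c} (M : Matrix a b) (N : Matrix b c) → (∀ k → Σℚ (N k) ≡ 0ℚ) →
            ∀ i → Σℚ ((M ⊗ N) i) ≡ 0ℚ
⊗-row-sum M N h i = trans (Σ-swap (λ j k → M i k * N k j))
  (Σ-zero (λ k → trans (Σ-*ˡ (M i k) (N k)) (trans (cong (M i k *_) (h k)) (ℚₚ.*-zeroʳ (M i k)))))

module _ {m} (A : Adj (suc m)) (connected : StronglyConnected A) (balanced : Balanced A)
  {K : Matrix (suc m) (suc m)} (mp : IsMoorePenrose (laplacian A) K) where

  private
    L P Q : Matrix (suc m) (suc m)
    L = laplacian A
    P = L ⊗ K
    Q i j = δ i j - P i j

    Q-left : ∀ i j → Σℚ (λ k → Q i k * L k j) ≡ 0ℚ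
    Q-left i j = begin
      Σℚ (λ k → Q i k * L k j)
        ≡⟨ Σ-cong (λ k → expand (δ i k) (P i k) (L k j)) ⟩
      Σℚ (λ k → δ i k * L k j - P i k * L k j)
        ≡⟨ Σ-minus (λ k → δ i k * L k j) (λ k → P i k * L k j) ⟩
      Σℚ (λ k → δ i k * L k j) - (P ⊗ L) i j
        ≡⟨ cong₂ _-_ (Σ-δˡ i (λ k → L k j)) (proj₁ mp i j) ⟩
      L i j - L i j
        ≡⟨ ℚₚ.+-inverseʳ (L i j) ⟩
      0ℚ ∎
      where
      open ≡-Reasoning
      expand : ∀ d p l → (d - p) * l ≡ d * l - p * l
      expand = solve-∀ ℚ-ring

    Q-sym : ∀ i j → Q i j ≡ Q j i
    Q-sym i j = cong₂ _-_ (δ-sym i j) (proj₁ (proj₂ (proj₂ mp)) j i)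

    -- By L K L = L every row of Q = I - L K lies in the left kernel of the Laplacian and is
    -- constant; the symmetry of L K then makes all entries of Q equal.
    Q-const : ∀ i j → Q i j ≡ Q zero zero
    Q-const i j = trans (row i j) (trans (Q-sym i zero) (row zero i))
      where
      row : ∀ i j → Q i j ≡ Q i zero
      row i j = laplacian-left-kernel A connected balanced (Q i) (Q-left i) j zero

  mean : ℚ
  mean = Q zero zero

  -- The columns of the Laplacian sum to 0, hence so do those of L K, and a column of I - L K sums
  -- to 1. This identifies `mean` as 1/n.
  Σ-mean : Σℚ {suc m} (λ _ → mean) ≡ 1ℚ
  Σ-mean = begin
    Σℚ {suc m} (λ _ → mean)
      ≡⟨ Σ-cong {suc m} (λ i → sym (Q-const i zero)) ⟩
    Σℚ (λ i → Q i zero)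
      ≡⟨ Σ-minus {suc m} (λ i → δ i zero) (λ i → P i zero) ⟩
    Σℚ {suc m} (λ i → δ i zero) - Σℚ (λ i → P i zero)
      ≡⟨ cong₂ _-_ (trans (Σ-cong {suc m} (λ i → sym (ℚₚ.*-identityˡ (δ i zero)))) (Σ-δʳ {suc m} zero (λ _ → 1ℚ)))
           (⊗-column-sum L K (laplacian-column-sum A balanced) zero) ⟩
    1ℚ - 0ℚ
      ≡⟨⟩
    1ℚ ∎
    where open ≡-Reasoning

  laplacian-⊗-pseudoinverse : ∀ i j → (laplacian A ⊗ K) i j + mean ≡ δ i j
  laplacian-⊗-pseudoinverse i j = trans (cong (P i j +_) (sym (Q-const i j))) (lemma (P i j) (δ i j))
    where
    lemma : ∀ p d → p + (d - p) ≡ d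
    lemma = solve-∀ ℚ-ring

  -- K = (K L) K, and K L is symmetric with row sums 0 because L has row sums 0; so its column sums
  -- are 0 too.
  pseudoinverse-column-sum : ∀ j → Σℚ (λ i → K i j) ≡ 0ℚ
  pseudoinverse-column-sum j = trans (Σ-cong (λ i → sym (proj₁ (proj₂ mp) i j)))
    (⊗-column-sum (K ⊗ L) K
      (λ k → trans (Σ-cong (λ i → proj₂ (proj₂ (proj₂ mp)) k i)) (⊗-row-sum K L (laplacian-row-sum A) k)) j)

  cofsum-pseudoinverse : ∀ r {η l} (s t : Selection η l (suc m)) →
    det (minor (laplacian A) r r) * cofsum (λ a b → K (pick s a) (pick t b)) ≡
    sgn (weight s ℕ.+ weight t) * det (λ a b → laplacian A (leave t a) (leave s b))
  cofsum-pseudoinverse = cofsum-inverse {L = laplacian A} {K} {mean} (laplacian-row-sum A) pseudoinverse-column-sum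
    laplacian-⊗-pseudoinverse Σ-mean

-- The matrix-tree theorem

Σᴸ : ∀ {X : Set} → (X → ℚ) → List X → ℚ
Σᴸ f []       = 0ℚ
Σᴸ f (x ∷ xs) = f x + Σᴸ f xs

Σᴸ-cong : ∀ {X : Set} {f g : X → ℚ} → f ≗ g → ∀ xs → Σᴸ f xs ≡ Σᴸ g xs
Σᴸ-cong h []       = refl
Σᴸ-cong h (x ∷ xs) = cong₂ _+_ (h x) (Σᴸ-cong h xs)

Σᴸ-++ : ∀ {X : Set} (f : X → ℚ) xs ys → Σᴸ f (xs ++ ys) ≡ Σᴸ f xs + Σᴸ f ys
Σᴸ-++ f []       ys = sym (ℚₚ.+-identityˡ _)
Σᴸ-++ f (x ∷ xs) ys = trans (cong (f x +_) (Σᴸ-++ f xs ys)) (sym (ℚₚ.+-assoc (f x) (Σᴸ f xs) (Σᴸ f ys)))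

Σᴸ-map : ∀ {X Y : Set} (f : Y → ℚ) (g : X → Y) xs → Σᴸ f (map g xs) ≡ Σᴸ (f ∘ g) xs
Σᴸ-map f g []       = refl
Σᴸ-map f g (x ∷ xs) = cong (f (g x) +_) (Σᴸ-map f g xs)

Σᴸ-cartesianProductWith : ∀ {X Y Z : Set} (f : Z → ℚ) (g : X → Y → Z) xs ys →
  Σᴸ f (cartesianProductWith g xs ys) ≡ Σᴸ (λ x → Σᴸ (λ y → f (g x y)) ys) xs
Σᴸ-cartesianProductWith f g []       ys = refl
Σᴸ-cartesianProductWith f g (x ∷ xs) ys = trans (Σᴸ-++ f (map (g x) ys) (cartesianProductWith g xs ys))
  (cong₂ _+_ (Σᴸ-map f (g x) ys) (Σᴸ-cartesianProductWith f g xs ys))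

linear-Σᴸ : ∀ {X : Set} {d} {f : Vector d → ℚ} → Linear f → ∀ (g : X → Vector d) xs →
            f (λ j → Σᴸ (λ x → g x j) xs) ≡ Σᴸ (λ x → f (g x)) xs
linear-Σᴸ         lin g []       = linear-0 lin
linear-Σᴸ {f = f} lin g (x ∷ xs) = trans (Linear.linear lin 1ℚ {v = g x} (λ j → cong (g x j +_) (sym (ℚₚ.*-identityˡ _))))
  (cong (f (g x) +_) (trans (ℚₚ.*-identityˡ _) (linear-Σᴸ lin g xs)))

choices : ∀ {X : Set} {k} → (Fin k → List X) → List (Vec X k)
choices {k = zero}  xs = [] ∷ []
choices {k = suc k} xs = cartesianProductWith _∷_ (xs zero) (choices (xs ∘ suc))

∈-choices⁺ : ∀ {X : Set} {k} (xs : Fin k → List X) (H : Vec X k) → (∀ i → lookup H i ∈ xs i) → H ∈ choices xs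
∈-choices⁺ xs []      h = here refl
∈-choices⁺ xs (x ∷ H) h = ∈-cartesianProductWith⁺ _∷_ (h zero) (∈-choices⁺ (xs ∘ suc) H (h ∘ suc))

∈-choices⁻ : ∀ {X : Set} {k} (xs : Fin k → List X) {H : Vec X k} → H ∈ choices xs → ∀ i → lookup H i ∈ xs i
∈-choices⁻ {k = suc k} xs H∈ i with ∈-cartesianProductWith⁻ _∷_ (xs zero) (choices (xs ∘ suc)) H∈
∈-choices⁻ {k = suc k} xs H∈ zero    | x , H , x∈ , H∈′ , refl = x∈
∈-choices⁻ {k = suc k} xs H∈ (suc i) | x , H , x∈ , H∈′ , refl = ∈-choices⁻ (xs ∘ suc) H∈′ i

choices-unique : ∀ {X : Set} {k} (xs : Fin k → List X) → (∀ i → Unique (xs i)) → Unique (choices xs)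
choices-unique {k = zero}  xs h = [] ∷ []
choices-unique {k = suc k} xs h =
  Uniqueₚ.cartesianProductWith⁺ _∷_ ∷-injective (h zero) (choices-unique (xs ∘ suc) (h ∘ suc))

-- Multilinearity: when every row is a sum, the value is the sum over all ways of choosing one
-- summand in each row.
alternating-expand : ∀ {X : Set} {m d} {F : Matrix m d → ℚ} → Alternating F →
  ∀ (xs : Fin m → List X) (row : Fin m → X → Vector d) →
  F (λ i j → Σᴸ (λ x → row i x j) (xs i)) ≡ Σᴸ (λ H → F (λ i → row i (lookup H i))) (choices xs)
alternating-expand {m = zero}          alt xs row =
  trans (respects alt (λ ())) (sym (ℚₚ.+-identityʳ _))
alternating-expand {m = suc m} {F = F} alt xs row = begin
  F (λ i j → Σᴸ (λ x → row i x j) (xs i))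
    ≡⟨ respects alt (λ { zero → λ _ → refl ; (suc k) → λ _ → refl }) ⟩
  F ((λ j → Σᴸ (λ x → row zero x j) (xs zero)) ∷ᵥ rest)
    ≡⟨ linear-Σᴸ (linear-first-row alt rest) (row zero) (xs zero) ⟩
  Σᴸ (λ x → F (row zero x ∷ᵥ rest)) (xs zero)
    ≡⟨ Σᴸ-cong (λ x → trans (alternating-expand (fix-first-row alt (row zero x)) (xs ∘ suc) (row ∘ suc))
         (Σᴸ-cong (λ H → respects alt (λ { zero → λ _ → refl ; (suc k) → λ _ → refl })) (choices (xs ∘ suc)))) (xs zero) ⟩
  Σᴸ (λ x → Σᴸ (λ H → F (λ i → row i (lookup (x ∷ H) i))) (choices (xs ∘ suc))) (xs zero)
    ≡⟨ sym (Σᴸ-cartesianProductWith (λ H → F (λ i → row i (lookup H i))) _∷_ (xs zero) (choices (xs ∘ suc))) ⟩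
  Σᴸ (λ H → F (λ i → row i (lookup H i))) (choices xs) ∎
  where
  open ≡-Reasoning
  rest : Matrix m _
  rest i j = Σᴸ (λ x → row (suc i) x j) (xs (suc i))

-- Cycles of functional graphs and the determinant of I - H

module _ {n} (H : Adj (suc n)) (next : Fin (suc n) → Fin (suc n)) (edge : ∀ i → Edge H i (next i)) where

  private
    walk : ℕ → Fin (suc n)
    walk zero    = zero
    walk (suc k) = next (walk k)

    -- A closed walk of length `suc d` either visits distinct vertices, and is a cycle, or has a
    -- repetition at s < t. In that case the stretch between them is a closed walk of length `suc o`
    -- with t = s + 1 + o and `o` below `d`.
    close : ∀ {d} → Acc ℕ._<_ d → ∀ i → walk i ≡ walk (i ℕ.+ suc d) → OrientedCycle H
    close {d} (acc rec) i returns
      with any? (λ (s : Fin (suc d)) → any? (λ (t : Fin (suc d)) →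
             (s Fin.<? t) ×-dec (walk (i ℕ.+ toℕ s) Fin.≟ walk (i ℕ.+ toℕ t))))
    ... | yes (s , t , s<t , same) with ℕₚ.m≤n⇒∃[o]m+o≡n s<t
    ...   | o , s+o≡t = close (rec o<d) (i ℕ.+ toℕ s)
              (trans same (cong walk (trans (cong (i ℕ.+_) (trans (sym s+o≡t) (sym (ℕₚ.+-suc (toℕ s) o))))
                                            (sym (ℕₚ.+-assoc i (toℕ s) (suc o))))))
      where
      o<d : o ℕ.< d
      o<d = ℕₚ.≤-trans (ℕₚ.≤-trans (ℕ.s≤s (ℕₚ.m≤n+m o (toℕ s))) (ℕₚ.≤-reflexive s+o≡t)) (ℕ.s≤s⁻¹ (toℕ<n t))
    close {d} (acc rec) i returns | no simple =
      d , (λ t → walk (i ℕ.+ toℕ t)) , injective , edges , closing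
      where
      injective : Injective _≡_ _≡_ (λ (t : Fin (suc d)) → walk (i ℕ.+ toℕ t))
      injective {s} {t} e with <-cmp s t
      ... | tri< s<t _ _ = ⊥-elim (simple (s , t , s<t , e))
      ... | tri≈ _ s≡t _ = s≡t
      ... | tri> _ _ t<s = ⊥-elim (simple (t , s , t<s , sym e))
      edges : ∀ (t : Fin d) → Edge H (walk (i ℕ.+ toℕ (inject₁ t))) (walk (i ℕ.+ toℕ (suc t)))
      edges t = subst₂ (λ a b → Edge H (walk a) (walk b))
        (cong (i ℕ.+_) (sym (toℕ-inject₁ t))) (sym (ℕₚ.+-suc i (toℕ t))) (edge (walk (i ℕ.+ toℕ t)))
      closing : Edge H (walk (i ℕ.+ toℕ (fromℕ d))) (walk (i ℕ.+ 0))
      closing = subst (λ k → Edge H (walk (i ℕ.+ k)) (walk (i ℕ.+ 0))) (sym (toℕ-fromℕ d))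
        (subst (Edge H (walk (i ℕ.+ d)))
          (trans (cong walk (sym (ℕₚ.+-suc i d))) (trans (sym returns) (cong walk (sym (ℕₚ.+-identityʳ i)))))
          (edge (walk (i ℕ.+ d))))

  sinkless-cycle : OrientedCycle H
  sinkless-cycle with pigeonhole (ℕₚ.n<1+n (suc n)) (walk ∘ toℕ)
  ... | s , t , s<t , same with ℕₚ.m≤n⇒∃[o]m+o≡n s<t
  ...   | o , s+o≡t = close (<-wellFounded o) (toℕ s)
            (trans same (cong walk (trans (sym s+o≡t) (sym (ℕₚ.+-suc (toℕ s) o)))))

zero-row-sums : ∀ {m} (M : Matrix (suc m) (suc m)) → (∀ i → Σℚ (M i) ≡ 0ℚ) → det M ≡ 0ℚ
zero-row-sums {m} M h = begin
  det M              ≡⟨ sym (ℚₚ.*-identityʳ (det M)) ⟩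
  det M * 1ℚ         ≡⟨ cong (det M *_) (sym det-E) ⟩
  det M * det E      ≡⟨ sym (det-⊗ M E) ⟩
  det (M ⊗ E)        ≡⟨ sym (det-transpose (M ⊗ E)) ⟩
  det (transpose (M ⊗ E)) ≡⟨ zero-row det-alternating zero {transpose (M ⊗ E)}
                               (λ i → trans (Σ-cong (λ k → ℚₚ.*-identityʳ (M i k))) (h i)) ⟩
  0ℚ                 ∎
  where
  open ≡-Reasoning
  -- The identity with its first column replaced by ones: multiplying by it on the right puts the
  -- row sums of `M` into the first column, and its determinant is 1.
  E : Matrix (suc m) (suc m)
  E i = 1ℚ ∷ᵥ δ i ∘ suc
  det-E : det E ≡ 1ℚ
  det-E = trans (det-unit-first-row E zero (λ { zero → refl ; (suc j) → refl }))
    (trans (ℚₚ.*-identityˡ (det (δ {m}))) (det-δ m))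

Functional : ∀ {n} → Adj n → Set
Functional H = ∀ {i j k} → Edge H i j → Edge H i k → j ≡ k

cycle-out-edge : ∀ {n} {H : Adj n} ((m , v , _) : OrientedCycle H) → ∀ t → ∃ (Edge H (v t))
cycle-out-edge {H = H} (m , v , _ , edges , closing) t with view t
... | ‵fromℕ     = v zero , closing
... | ‵inject₁ s = v (suc s) , edges s

false≢true : ∀ {b} → b ≡ false → b ≢ true
false≢true refl ()

-- Every vertex of a cycle has an out-edge, so the cycle avoids the sink and can be relabelled.
remove-sink : ∀ {n} (H : Adj (suc n)) i → (∀ j → H i j ≡ false) → OrientedCycle H →
              OrientedCycle (λ a b → H (punchIn i a) (punchIn i b))
remove-sink H i sink cycle@(m , v , inj , edges , closing) =
  m , v′ , (λ e → inj (punchOut-injective (i≢v _) (i≢v _) e)) ,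
  (λ t → restore (v (inject₁ t)) (v (suc t)) (i≢v _) (i≢v _) (edges t)) ,
  restore (v (fromℕ m)) (v zero) (i≢v _) (i≢v _) closing
  where
  i≢v : ∀ t → i ≢ v t
  i≢v t refl with cycle-out-edge {H = H} cycle t
  ... | j , e = false≢true (sink j) e
  v′ : Fin (suc m) → Fin _
  v′ t = punchOut (i≢v t)
  restore : ∀ x y (i≢x : i ≢ x) (i≢y : i ≢ y) → Edge H x y →
            Edge H (punchIn i (punchOut i≢x)) (punchIn i (punchOut i≢y))
  restore x y i≢x i≢y e = trans (cong₂ H (punchIn-punchOut i≢x) (punchIn-punchOut i≢y)) e

restore-sink : ∀ {n} (H : Adj (suc n)) i → OrientedCycle (λ a b → H (punchIn i a) (punchIn i b)) → OrientedCycle H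
restore-sink H i (m , v , inj , edges , closing) =
  m , punchIn i ∘ v , (λ e → inj (punchIn-injective i _ _ e)) , edges , closing

I-minus : ∀ {n} → Adj n → Matrix n n
I-minus H i j = δ i j - b2ℚ (H i j)

det-sink : ∀ {n} (H : Adj (suc n)) i → (∀ j → H i j ≡ false) →
           det (I-minus H) ≡ det (I-minus (λ a b → H (punchIn i a) (punchIn i b)))
det-sink H i sink = begin
  det (I-minus H)
    ≡⟨ det-unit-row (I-minus H) i i (λ j → trans (cong (λ b → δ i j - b2ℚ b) (sink j)) (ℚₚ.+-identityʳ (δ i j))) ⟩
  sgn (toℕ i ℕ.+ toℕ i) * det (minor (I-minus H) i i)
    ≡⟨ cong₂ _*_ (trans (sgn-+ (toℕ i) (toℕ i)) (sgn-square (toℕ i)))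
         (det-cong (λ a b → cong (_- b2ℚ (H (punchIn i a) (punchIn i b))) (δ-punchIn i a b))) ⟩
  1ℚ * det (I-minus (λ a b → H (punchIn i a) (punchIn i b)))
    ≡⟨ ℚₚ.*-identityˡ _ ⟩
  det (I-minus (λ a b → H (punchIn i a) (punchIn i b))) ∎
  where open ≡-Reasoning

-- Deleting a sink changes neither the cycles nor the determinant, because its row in I - H is a
-- unit vector. Without sinks every vertex has exactly one out-edge, so the row sums of I - H are 0
-- and following the edges leads into a cycle. The disjunction also decides acyclicity.
functional-det : ∀ {n} (H : Adj n) → Functional H →
  (¬ OrientedCycle H × det (I-minus H) ≡ 1ℚ) ⊎ (OrientedCycle H × det (I-minus H) ≡ 0ℚ)
functional-det {zero}  H functional = inj₁ ((λ { (m , v , _) → noFin (v zero) }) , refl)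
  where
  noFin : ¬ Fin 0
  noFin ()
functional-det {suc n} H functional with any? (λ i → all? (λ j → H i j Boolₚ.≟ false))
... | yes (i , sink) with functional-det H′ (λ e e′ → punchIn-injective i _ _ (functional e e′))
  where
  H′ : Adj n
  H′ a b = H (punchIn i a) (punchIn i b)
...   | inj₁ (acyclic , d) = inj₁ (acyclic ∘ remove-sink H i sink , trans (det-sink H i sink) d)
...   | inj₂ (cycle , d)   = inj₂ (restore-sink H i cycle , trans (det-sink H i sink) d)
functional-det {suc n} H functional | no no-sink =
  inj₂ (sinkless-cycle H (proj₁ ∘ out) (proj₂ ∘ out) , zero-row-sums (I-minus H) row-sum)
  where
  out : ∀ i → ∃ λ j → Edge H i j
  out i with ¬∀⟶∃¬ _ (λ j → H i j ≡ false) (λ j → H i j Boolₚ.≟ false) (λ h → no-sink (i , h))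
  ... | j , ≢false = j , Boolₚ.¬-not ≢false
  row : ∀ i j → b2ℚ (H i j) ≡ δ (proj₁ (out i)) j
  row i j with H i j in e
  ... | true  = sym (trans (cong (δ (proj₁ (out i))) (functional e (proj₂ (out i)))) (δ-diag (proj₁ (out i))))
  ... | false = sym (δ-off {i = proj₁ (out i)} {j} (λ { refl → false≢true e (proj₂ (out i)) }))
  Σ-δ : ∀ {m} (i : Fin m) → Σℚ (δ i) ≡ 1ℚ
  Σ-δ i = trans (Σ-cong (λ j → sym (ℚₚ.*-identityʳ (δ i j)))) (Σ-δˡ i (λ _ → 1ℚ))
  row-sum : ∀ i → Σℚ (I-minus H i) ≡ 0ℚ
  row-sum i = trans (Σ-cong (λ j → cong (λ x → δ i j - x) (row i j)))
    (trans (Σ-minus (δ i) (δ (proj₁ (out i)))) (trans (cong₂ _-_ (Σ-δ i) (Σ-δ (proj₁ (out i)))) (ℚₚ.+-inverseʳ 1ℚ)))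

-- Choices of out-edges, and the spanning trees among them

⊥-row : ∀ {n} (S : Subset n) → Σℕ (b2ℕ ∘ lookup S) ≡ 0 → S ≡ ⊥
⊥-row []          e = refl
⊥-row (false ∷ S) e = cong (false ∷_) (⊥-row S e)

⊥-lookup : ∀ {n} (j : Fin n) → lookup ⊥ j ≡ false
⊥-lookup j = lookup-replicate j false

⊥-count : ∀ n → Σℕ (b2ℕ ∘ lookup (⊥ {n})) ≡ 0
⊥-count zero    = refl
⊥-count (suc n) = ⊥-count n

singleton-row : ∀ {n} (S : Subset n) → Σℕ (b2ℕ ∘ lookup S) ≡ 1 → ∃ λ j → S ≡ ⁅ j ⁆
singleton-row (true ∷ S)  e = zero , cong (true ∷_) (⊥-row S (ℕₚ.suc-injective e))
singleton-row (false ∷ S) e with singleton-row S e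
... | j , refl = suc j , refl

singleton-count : ∀ {n} (j : Fin n) → Σℕ (b2ℕ ∘ lookup ⁅ j ⁆) ≡ 1
singleton-count {suc n} zero    = cong suc (⊥-count n)
singleton-count         (suc j) = singleton-count j

singleton-lookup : ∀ {n} (j : Fin n) → lookup ⁅ j ⁆ j ≡ true
singleton-lookup j = []=⇒lookup (x∈⁅x⁆ j)

singleton-lookup⁻ : ∀ {n} (j : Fin n) {k} → lookup ⁅ j ⁆ k ≡ true → k ≡ j
singleton-lookup⁻ j {k} e = x∈⁅y⁆⇒x≡y j (lookup⇒[]= k ⁅ j ⁆ e)

singleton-δ : ∀ {n} (j k : Fin n) → b2ℚ (lookup ⁅ j ⁆ k) ≡ δ j k
singleton-δ zero    zero    = refl
singleton-δ zero    (suc k) = cong b2ℚ (⊥-lookup k)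
singleton-δ (suc j) zero    = refl
singleton-δ (suc j) (suc k) = singleton-δ j k

successors : ∀ {n} → Adj n → Fin n → List (Fin n)
successors A i = filter (λ j → A i j Boolₚ.≟ true) (allFin _)

Σᴸ-filter : ∀ {X : Set} (g : X → ℚ) (p : X → Bool) {k} (h : Fin k → X) →
  Σᴸ g (filter (λ x → p x Boolₚ.≟ true) (tabulate h)) ≡ Σℚ (λ j → b2ℚ (p (h j)) * g (h j))
Σᴸ-filter g p {zero}  h = refl
Σᴸ-filter g p {suc k} h with p (h zero)
... | true  = cong₂ _+_ (sym (ℚₚ.*-identityˡ (g (h zero)))) (Σᴸ-filter g p (h ∘ suc))
... | false = trans (Σᴸ-filter g p (h ∘ suc))
  (sym (trans (cong (_+ Σℚ (λ j → b2ℚ (p (h (suc j))) * g (h (suc j)))) (ℚₚ.*-zeroˡ (g (h zero)))) (ℚₚ.+-identityˡ _)))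

module _ {n} (A : Adj n) (root : Fin n) where

  -- The possible rows of a spanning subgraph with prescribed outdegrees: the empty set at the root,
  -- and the singleton of one successor elsewhere.
  out-rows : Fin n → List (Subset n)
  out-rows i with i Fin.≟ root
  ... | yes _ = ⊥ ∷ []
  ... | no _  = map ⁅_⁆ (successors A i)

  row-vector : Fin n → Subset n → Vector n
  row-vector i S j = δ i j - b2ℚ (lookup S j)

  -- The Laplacian with the row of the root replaced by a unit vector. Row i off the root is the sum
  -- of e_i - e_k over the edges i → k, which makes it ready for `alternating-expand`.
  rooted : Matrix n n
  rooted i j = Σᴸ (λ S → row-vector i S j) (out-rows i)

  rooted-root : ∀ j → rooted root j ≡ δ root j
  rooted-root j with root Fin.≟ root
  ... | yes _ = trans (ℚₚ.+-identityʳ _) (trans (cong (λ b → δ root j - b2ℚ b) (⊥-lookup j)) (ℚₚ.+-identityʳ (δ root j)))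
  ... | no r≢r = ⊥-elim (r≢r refl)

  rooted-laplacian : ∀ i j → i ≢ root → rooted i j ≡ laplacian A i j
  rooted-laplacian i j i≢r with i Fin.≟ root
  ... | yes i≡r = ⊥-elim (i≢r i≡r)
  ... | no _    = begin
    Σᴸ (λ S → row-vector i S j) (map ⁅_⁆ (successors A i))
      ≡⟨ Σᴸ-map (λ S → row-vector i S j) ⁅_⁆ (successors A i) ⟩
    Σᴸ (λ k → row-vector i ⁅ k ⁆ j) (successors A i)
      ≡⟨ Σᴸ-filter (λ k → row-vector i ⁅ k ⁆ j) (A i) (λ k → k) ⟩
    Σℚ (λ k → b2ℚ (A i k) * (δ i j - b2ℚ (lookup ⁅ k ⁆ j)))
      ≡⟨ Σ-cong (λ k → trans (cong (λ x → b2ℚ (A i k) * (δ i j - x)) (singleton-δ k j))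
           (expand (b2ℚ (A i k)) (δ i j) (δ k j))) ⟩
    Σℚ (λ k → b2ℚ (A i k) * δ i j - b2ℚ (A i k) * δ k j)
      ≡⟨ Σ-minus (λ k → b2ℚ (A i k) * δ i j) (λ k → b2ℚ (A i k) * δ k j) ⟩
    Σℚ (λ k → b2ℚ (A i k) * δ i j) - Σℚ (λ k → b2ℚ (A i k) * δ k j)
      ≡⟨ cong₂ _-_ (Σ-*ʳ (δ i j) (b2ℚ ∘ A i)) (Σ-δʳ j (b2ℚ ∘ A i)) ⟩
    Σℚ (b2ℚ ∘ A i) * δ i j - b2ℚ (A i j)
      ≡⟨ sym (laplacian-entry A i j) ⟩
    laplacian A i j ∎
    where
    open ≡-Reasoning
    expand : ∀ a x y → a * (x - y) ≡ a * x - a * y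
    expand = solve-∀ ℚ-ring

  candidates : List (Subgraph n)
  candidates = choices out-rows

  det-rooted : det rooted ≡ Σᴸ (λ H → det (I-minus (edgeOf H))) candidates
  det-rooted = alternating-expand det-alternating out-rows row-vector

  out-rows-unique : ∀ i → Unique (out-rows i)
  out-rows-unique i with i Fin.≟ root
  ... | yes _ = [] ∷ []
  ... | no _  = Uniqueₚ.map⁺ singleton-injective (Uniqueₚ.filter⁺ (λ j → A i j Boolₚ.≟ true) (Uniqueₚ.allFin⁺ n))
    where
    singleton-injective : ∀ {j k : Fin n} → ⁅ j ⁆ ≡ ⁅ k ⁆ → j ≡ k
    singleton-injective {j} {k} e = singleton-lookup⁻ k (subst (λ S → lookup S j ≡ true) e (singleton-lookup j))

  data OutRow (i : Fin n) (S : Subset n) : Set where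
    at-root  : i ≡ root → S ≡ ⊥ → OutRow i S
    off-root : i ≢ root → ∀ j → Edge A i j → S ≡ ⁅ j ⁆ → OutRow i S

  out-row⁻ : ∀ i {S} → S ∈ out-rows i → OutRow i S
  out-row⁻ i S∈ with i Fin.≟ root
  out-row⁻ i (here S≡⊥) | yes i≡r = at-root i≡r S≡⊥
  out-row⁻ i S∈         | no i≢r with ∈-map⁻ ⁅_⁆ S∈
  ... | j , j∈ , refl = off-root i≢r j (proj₂ (∈-filter⁻ (λ j → A i j Boolₚ.≟ true) {xs = allFin n} j∈)) refl

  out-row⁺ : ∀ i {S} → OutRow i S → S ∈ out-rows i
  out-row⁺ i r with i Fin.≟ root
  out-row⁺ i (at-root _ S≡⊥)         | yes _   = here S≡⊥
  out-row⁺ i (off-root i≢r _ _ _)    | yes i≡r = ⊥-elim (i≢r i≡r)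
  out-row⁺ i (at-root i≡r _)         | no i≢r  = ⊥-elim (i≢r i≡r)
  out-row⁺ i (off-root _ j e refl)   | no _    =
    ∈-map⁺ ⁅_⁆ (∈-filter⁺ (λ j → A i j Boolₚ.≟ true) (∈-allFin j) e)

  out-row-edge : ∀ {i S j} → OutRow i S → lookup S j ≡ true → S ≡ ⁅ j ⁆ × Edge A i j
  out-row-edge {j = j} (at-root _ refl)      e = ⊥-elim (false≢true (⊥-lookup j) e)
  out-row-edge         (off-root _ k e refl) l with refl ← singleton-lookup⁻ k l = refl , e

  candidate-row : ∀ {H} → H ∈ candidates → ∀ i → OutRow i (lookup H i)
  candidate-row H∈ i = out-row⁻ i (∈-choices⁻ out-rows H∈ i)

  candidate-functional : ∀ {H} → H ∈ candidates → Functional (edgeOf H)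
  candidate-functional {H} H∈ {i} {j} {k} e e′ =
    singleton-lookup⁻ k (subst (λ S → lookup S j ≡ true) (proj₁ (out-row-edge (candidate-row H∈ i) e′)) e)

  candidate-tree : ∀ {H} → H ∈ candidates → ¬ OrientedCycle (edgeOf H) → IsOrientedSpanningTree A root H
  candidate-tree {H} H∈ acyclic =
    (λ i j e → proj₂ (out-row-edge (candidate-row H∈ i) e)) , acyclic , root-count , count
    where
    root-count : outdeg (edgeOf H) root ≡ 0
    root-count with candidate-row H∈ root
    ... | at-root _ S≡⊥      = trans (cong (λ S → Σℕ (b2ℕ ∘ lookup S)) S≡⊥) (⊥-count n)
    ... | off-root r≢r _ _ _ = ⊥-elim (r≢r refl)
    count : ∀ v → v ≢ root → outdeg (edgeOf H) v ≡ 1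
    count v v≢r with candidate-row H∈ v
    ... | at-root v≡r _        = ⊥-elim (v≢r v≡r)
    ... | off-root _ j _ S≡⁅j⁆ = trans (cong (λ S → Σℕ (b2ℕ ∘ lookup S)) S≡⁅j⁆) (singleton-count j)

  tree-candidate : ∀ {H} → IsOrientedSpanningTree A root H → H ∈ candidates
  tree-candidate {H} (sub , _ , root-count , count) = ∈-choices⁺ out-rows H (λ i → out-row⁺ i (row i))
    where
    row : ∀ i → OutRow i (lookup H i)
    row i with i Fin.≟ root
    ... | yes refl = at-root refl (⊥-row (lookup H i) root-count)
    ... | no i≢r with singleton-row (lookup H i) (count i i≢r)
    ...   | j , e = off-root i≢r j (sub i j (trans (cong (λ S → lookup S j) e) (singleton-lookup j))) e

det-rooted-minor : ∀ {m} (A : Adj (suc m)) root → det (rooted A root) ≡ det (minor (laplacian A) root root)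
det-rooted-minor A root = trans (det-unit-row (rooted A root) root root (rooted-root A root))
  (trans (cong₂ _*_ (trans (sgn-+ (toℕ root) (toℕ root)) (sgn-square (toℕ root)))
           (det-cong (λ a b → rooted-laplacian A root (punchIn root a) (punchIn root b) (punchInᵢ≢i root a))))
         (ℚₚ.*-identityˡ _))

Σᴸ-indicator : ∀ {X : Set} (f : X → ℚ) xs → (∀ {x} → x ∈ xs → f x ≡ 1ℚ ⊎ f x ≡ 0ℚ) →
               Σᴸ f xs ≡ natℚ (length (filter (λ x → f x ℚₚ.≟ 1ℚ) xs))
Σᴸ-indicator f []       h = refl
Σᴸ-indicator f (x ∷ xs) h with f x ℚₚ.≟ 1ℚ | h (here refl)
... | yes e | _       = trans (cong₂ _+_ e (Σᴸ-indicator f xs (h ∘ there)))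
                          (sym (natℚ-+ 1 (length (filter (λ x → f x ℚₚ.≟ 1ℚ) xs))))
... | no ≢1 | inj₁ ≡1 = ⊥-elim (≢1 ≡1)
... | no _  | inj₂ ≡0 = trans (cong₂ _+_ ≡0 (Σᴸ-indicator f xs (h ∘ there))) (ℚₚ.+-identityˡ _)

-- Each candidate contributes 1 or 0, so the determinant counts the candidates of value 1, which are
-- the acyclic ones. That list and `T` have no duplicates and the same members, hence the same
-- length. The filter tests the value because equality of rationals is decidable.
matrix-tree : ∀ {m} (A : Adj (suc m)) root (T : List (Subgraph (suc m))) → Unique T →
  (∀ H → (H ∈ T → IsOrientedSpanningTree A root H) × (IsOrientedSpanningTree A root H → H ∈ T)) →
  natℚ (length T) ≡ det (minor (laplacian A) root root)
matrix-tree A root T unique trees = begin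
  natℚ (length T)
    ≡⟨ cong natℚ (↭-length (∼bag⇒↭ (unique∧set⇒bag unique
         (Uniqueₚ.filter⁺ one? (choices-unique (out-rows A root) (out-rows-unique A root))) (mk⇔ to from)))) ⟩
  natℚ (length (filter one? C))
    ≡⟨ sym (Σᴸ-indicator value C (λ {H} H∈ → Sum.map proj₂ proj₂ (dichotomy H H∈))) ⟩
  Σᴸ value C
    ≡⟨ sym (det-rooted A root) ⟩
  det (rooted A root)
    ≡⟨ det-rooted-minor A root ⟩
  det (minor (laplacian A) root root) ∎
  where
  open ≡-Reasoning
  C : List (Subgraph _)
  C = candidates A root
  value : Subgraph _ → ℚ
  value H = det (I-minus (edgeOf H))
  one? : ∀ H → Dec (value H ≡ 1ℚ)
  one? H = value H ℚₚ.≟ 1ℚ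
  dichotomy : ∀ H → H ∈ C → (¬ OrientedCycle (edgeOf H) × value H ≡ 1ℚ) ⊎ (OrientedCycle (edgeOf H) × value H ≡ 0ℚ)
  dichotomy H H∈ = functional-det (edgeOf H) (candidate-functional A root {H} H∈)
  to : ∀ {H} → H ∈ T → H ∈ filter one? C
  to {H} H∈T with dichotomy H (tree-candidate A root {H} (proj₁ (trees H) H∈T))
  ... | inj₁ (_ , e)     = ∈-filter⁺ one? (tree-candidate A root {H} (proj₁ (trees H) H∈T)) e
  ... | inj₂ (cycle , _) = ⊥-elim (proj₁ (proj₂ (proj₁ (trees H) H∈T)) cycle)
  from : ∀ {H} → H ∈ filter one? C → H ∈ T
  from {H} H∈ with ∈-filter⁻ one? {v = H} {xs = C} H∈
  ... | H∈C , e with dichotomy H H∈C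
  ...   | inj₁ (acyclic , _) = proj₂ (trees H) (candidate-tree A root {H} H∈C acyclic)
  ...   | inj₂ (_ , e′) with () ← trans (sym e) e′

-- The two identities

power-−2 : ∀ k → power (- natℚ 2) k ≡ sgn k * natℚ (2 ^ k)
power-−2 zero    = refl
power-−2 (suc k) = begin
  - natℚ 2 * power (- natℚ 2) k             ≡⟨ cong (- natℚ 2 *_) (power-−2 k) ⟩
  - natℚ 2 * (sgn k * natℚ (2 ^ k))         ≡⟨ double (sgn k) (natℚ (2 ^ k)) ⟩
  (- sgn k) * (natℚ (2 ^ k) + (natℚ (2 ^ k) + 0ℚ)) ≡⟨ cong₂ _*_ (sym (sgn-suc k)) (sym powers) ⟩
  sgn (suc k) * natℚ (2 ^ suc k)            ∎
  where
  open ≡-Reasoning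
  -- `1ℚ + 1ℚ` is `natℚ 2`, and the trailing `0ℚ` comes from `2 ^ suc k` unfolding to
  -- `2 ^ k + (2 ^ k + 0)`.
  double : ∀ s x → - (1ℚ + 1ℚ) * (s * x) ≡ (- s) * (x + (x + 0ℚ))
  double = solve-∀ ℚ-ring
  powers : natℚ (2 ^ suc k) ≡ natℚ (2 ^ k) + (natℚ (2 ^ k) + 0ℚ)
  powers = trans (natℚ-+ (2 ^ k) (2 ^ k ℕ.+ 0)) (cong (natℚ (2 ^ k) +_) (natℚ-+ (2 ^ k) 0))

-- Here `u` and `v` are weights, `t` is the triangular number and `suc k` is η. The two copies of
-- `t` form an even exponent, and the sign of (-2)^k supplies the summand η - 1.
sign-power : ∀ u v k t d →
  sgn (u ℕ.+ v) * (power (- natℚ 2) k * d) ≡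
  sgn (((u ℕ.+ t) ℕ.+ (v ℕ.+ t) ℕ.+ suc k) ∸ 1) * (natℚ (2 ^ k) * d)
sign-power u v k t d = begin
  sgn (u ℕ.+ v) * (power (- natℚ 2) k * d)
    ≡⟨ cong (λ x → sgn (u ℕ.+ v) * (x * d)) (power-−2 k) ⟩
  sgn (u ℕ.+ v) * (sgn k * natℚ (2 ^ k) * d)
    ≡⟨ regroup (sgn (u ℕ.+ v)) (sgn k) (natℚ (2 ^ k)) d ⟩
  1ℚ * (sgn (u ℕ.+ v) * sgn k) * (natℚ (2 ^ k) * d)
    ≡⟨ cong (_* (natℚ (2 ^ k) * d)) (cong₂ _*_ (sym (trans (sgn-+ t t) (sgn-square t))) (sym (sgn-+ (u ℕ.+ v) k))) ⟩
  sgn (t ℕ.+ t) * sgn (u ℕ.+ v ℕ.+ k) * (natℚ (2 ^ k) * d)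
    ≡⟨ cong (_* (natℚ (2 ^ k) * d)) (sym (sgn-+ (t ℕ.+ t) (u ℕ.+ v ℕ.+ k))) ⟩
  sgn (t ℕ.+ t ℕ.+ (u ℕ.+ v ℕ.+ k)) * (natℚ (2 ^ k) * d)
    ≡⟨ cong (λ x → sgn x * (natℚ (2 ^ k) * d)) (sym exponent) ⟩
  sgn (((u ℕ.+ t) ℕ.+ (v ℕ.+ t) ℕ.+ suc k) ∸ 1) * (natℚ (2 ^ k) * d) ∎
  where
  open ≡-Reasoning
  regroup : ∀ s r x d → s * (r * x * d) ≡ 1ℚ * (s * r) * (x * d)
  regroup = solve-∀ ℚ-ring
  exponent : ((u ℕ.+ t) ℕ.+ (v ℕ.+ t) ℕ.+ suc k) ∸ 1 ≡ t ℕ.+ t ℕ.+ (u ℕ.+ v ℕ.+ k)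
  exponent = trans (cong (_∸ 1) (ℕₚ.+-suc ((u ℕ.+ t) ℕ.+ (v ℕ.+ t)) k))
    (solve 4 (λ u v t k → (u :+ t) :+ (v :+ t) :+ k := t :+ t :+ (u :+ v :+ k)) refl u v t k)
    where open Data.Nat.Solver.+-*-Solver

module _ {m} (A : Adj (suc m)) (connected : StronglyConnected A) (balanced : Balanced A)
  {K : Matrix (suc m) (suc m)} (mp : IsMoorePenrose (laplacian A) K) (root : Fin (suc m)) where

  -- The sizes and the exponents `a`, `b` are variables so that the equations can be matched with
  -- `refl`, which is impossible for cardinalities of given subsets. The argument in `Fin η`
  -- excludes η = 0.
  cofsum-selections : ∀ {η l η′ l′} (s : Selection η l (suc m)) (t : Selection η′ l′ (suc m))
    (eq : η ≡ η′) (eq′ : l′ ≡ l) → Fin η →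
    ∀ {a b} → a ≡ weight s ℕ.+ triangle η → b ≡ weight t ℕ.+ triangle η′ →
    det (minor (laplacian A) root root) * cofsum (λ i j → resistance K (pick s i) (pick t (cast eq j))) ≡
    sgn ((a ℕ.+ b ℕ.+ η) ∸ 1) *
      (natℚ (2 ^ (η ∸ 1)) * det (λ i j → laplacian A (leave t i) (leave s (cast eq′ j))))
  cofsum-selections {suc k} s t refl refl _ refl refl = begin
    κ * cofsum (λ i j → resistance K (pick s i) (pick t (cast refl j)))
      ≡⟨ cong (κ *_) (cofsum-cong (λ i j → cong (λ x → resistance K (pick s i) (pick t x)) (cast-is-id refl j))) ⟩
    κ * cofsum (λ i j → resistance K (pick s i) (pick t j))
      ≡⟨ cong (κ *_) (cofsum-resistance K (pick s) (pick t)) ⟩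
    κ * (power (- natℚ 2) k * C)
      ≡⟨ exchange κ (power (- natℚ 2) k) C ⟩
    power (- natℚ 2) k * (κ * C)
      ≡⟨ cong (power (- natℚ 2) k *_) (cofsum-pseudoinverse A connected balanced mp root s t) ⟩
    power (- natℚ 2) k * (sgn (weight s ℕ.+ weight t) * D)
      ≡⟨ exchange (power (- natℚ 2) k) (sgn (weight s ℕ.+ weight t)) D ⟩
    sgn (weight s ℕ.+ weight t) * (power (- natℚ 2) k * D)
      ≡⟨ sign-power (weight s) (weight t) k (triangle (suc k)) D ⟩
    sgn (e ∸ 1) * (natℚ (2 ^ k) * D)
      ≡⟨ cong (λ x → sgn (e ∸ 1) * (natℚ (2 ^ k) * x))
           (det-cong (λ i j → cong (λ x → laplacian A (leave t i) (leave s x)) (sym (cast-is-id refl j)))) ⟩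
    sgn (e ∸ 1) * (natℚ (2 ^ k) * det (λ i j → laplacian A (leave t i) (leave s (cast refl j)))) ∎
    where
    open ≡-Reasoning
    κ C D : ℚ
    κ = det (minor (laplacian A) root root)
    C = cofsum (λ i j → K (pick s i) (pick t j))
    D = det (λ i j → laplacian A (leave t i) (leave s j))
    e : ℕ
    e = weight s ℕ.+ triangle (suc k) ℕ.+ (weight t ℕ.+ triangle (suc k)) ℕ.+ suc k
    exchange : ∀ x y z → x * (y * z) ≡ y * (x * z)
    exchange = solve-∀ ℚ-ring

  cofsum-subsets : ∀ (Ω₁ Ω₂ : Subset (suc m)) (eq : ∣ Ω₁ ∣ ≡ ∣ Ω₂ ∣) → Fin ∣ Ω₁ ∣ →
    det (minor (laplacian A) root root) * cofsum (sub (resistance K) Ω₁ Ω₂ eq) ≡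
    sgn ((α Ω₁ ℕ.+ α Ω₂ ℕ.+ ∣ Ω₁ ∣) ∸ 1) *
      (natℚ (2 ^ (∣ Ω₁ ∣ ∸ 1)) * det (sub (laplacian A) (∁ Ω₂) (∁ Ω₁) (∣∁∣-eq Ω₂ Ω₁ (sym eq))))
  cofsum-subsets Ω₁ Ω₂ eq x = trans
    (cong (det (minor (laplacian A) root root) *_) (cofsum-cong (λ i j → sym
      (cong₂ (resistance K) (pick-fromSubset Ω₁ i) (pick-fromSubset Ω₂ (cast eq j))))))
    (trans (cofsum-selections (fromSubset Ω₁) (fromSubset Ω₂) eq eq′ x (α-weight Ω₁) (α-weight Ω₂))
      (cong (λ d → sgn ((α Ω₁ ℕ.+ α Ω₂ ℕ.+ ∣ Ω₁ ∣) ∸ 1) * (natℚ (2 ^ (∣ Ω₁ ∣ ∸ 1)) * d))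
        (det-cong (λ i j → cong₂ (laplacian A) (leave-fromSubset Ω₂ i) (leave-fromSubset Ω₁ (cast eq′ j))))))
    where
    eq′ : ∣ ∁ Ω₂ ∣ ≡ ∣ ∁ Ω₁ ∣
    eq′ = ∣∁∣-eq Ω₂ Ω₁ (sym eq)

-- Two-element subsets

elems-onto : ∀ {n} (p : Subset n) i → lookup p i ≡ true → ∃ λ a → elems p a ≡ i
elems-onto (true ∷ p)  zero    e = zero , refl
elems-onto (true ∷ p)  (suc i) e with elems-onto p i e
... | a , refl = suc a , refl
elems-onto (false ∷ p) (suc i) e with elems-onto p i e
... | a , refl = a , refl

elems-member : ∀ {n} (p : Subset n) a → lookup p (elems p a) ≡ true
elems-member (true ∷ p)  zero    = refl
elems-member (true ∷ p)  (suc a) = elems-member p a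
elems-member (false ∷ p) a       = elems-member p a

elems-injective : ∀ {n} (p : Subset n) {a b} → elems p a ≡ elems p b → a ≡ b
elems-injective (true ∷ p)  {zero}  {zero}  e = refl
elems-injective (true ∷ p)  {suc a} {suc b} e = cong suc (elems-injective p (suc-injective e))
elems-injective (false ∷ p) {a}     {b}     e = elems-injective p (suc-injective e)

module _ {n} (i j : Fin n) where

  pair-left : lookup (pair i j) i ≡ true
  pair-left = trans (lookup∘tabulate _ i) test
    where
    test : (if does (i Fin.≟ i) then true else does (i Fin.≟ j)) ≡ true
    test with i Fin.≟ i
    ... | yes _  = refl
    ... | no i≢i = ⊥-elim (i≢i refl)

  pair-right : lookup (pair i j) j ≡ true
  pair-right = trans (lookup∘tabulate _ j) test
    where
    test : (if does (j Fin.≟ i) then true else does (j Fin.≟ j)) ≡ true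
    test with j Fin.≟ i | j Fin.≟ j
    ... | yes _ | _      = refl
    ... | no _  | yes _  = refl
    ... | no _  | no j≢j = ⊥-elim (j≢j refl)

  pair-member : ∀ k → lookup (pair i j) k ≡ true → k ≡ i ⊎ k ≡ j
  pair-member k e = test (trans (sym (lookup∘tabulate _ k)) e)
    where
    test : (if does (k Fin.≟ i) then true else does (k Fin.≟ j)) ≡ true → k ≡ i ⊎ k ≡ j
    test e with k Fin.≟ i | k Fin.≟ j
    ... | yes k≡i | _       = inj₁ k≡i
    ... | no _    | yes k≡j = inj₂ k≡j
    test () | no _ | no _

cofsum-2×2 : (B : Matrix 2 2) → cofsum B ≡
  (B zero zero + B (suc zero) (suc zero)) - (B zero (suc zero) + B (suc zero) zero)
cofsum-2×2 B = lemma (B zero zero) (B zero (suc zero)) (B (suc zero) zero) (B (suc zero) (suc zero))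
  where
  -- The left side is `cofsum B` unfolded for order two, each minor being a 1×1 determinant.
  lemma : ∀ a b c d →
    (1ℚ * (1ℚ * (d * 1ℚ) + 0ℚ) + (- 1ℚ * (1ℚ * (c * 1ℚ) + 0ℚ) + 0ℚ)) +
    ((- 1ℚ * (1ℚ * (b * 1ℚ) + 0ℚ) + (1ℚ * (1ℚ * (a * 1ℚ) + 0ℚ) + 0ℚ)) + 0ℚ) ≡ (a + d) - (b + c)
  lemma = solve-∀ ℚ-ring

-- `pair i j` has no computed size or order, so both are recovered from an injective enumeration `p`
-- with values `i` and `j`: one index would force i = j, three would collide, and for two both
-- orders give the same sum because the diagonal entries are 0.
two-points : ∀ {n η} (W : Matrix n n) (p : Fin η → Fin n) {i j} → (∀ {a b} → p a ≡ p b → a ≡ b) →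
  i ≢ j → (∃ λ a → p a ≡ i) → (∃ λ b → p b ≡ j) → (∀ c → p c ≡ i ⊎ p c ≡ j) →
  W i i ≡ 0ℚ → W j j ≡ 0ℚ →
  η ≡ 2 × cofsum (λ a b → W (p a) (p (cast refl b))) ≡ - (W i j + W j i)
two-points {η = 1} W p inj i≢j (zero , a) (zero , b) only Wii Wjj = ⊥-elim (i≢j (trans (sym a) b))
two-points {η = 2} W p {i} {j} inj i≢j a b only Wii Wjj =
  refl , trans (cofsum-2×2 (λ a b → W (p a) (p (cast refl b)))) (entries a b)
  where
  simplify : ∀ x y → (0ℚ + 0ℚ) - (x + y) ≡ - (x + y)
  simplify = solve-∀ ℚ-ring
  simplify′ : ∀ x y → (0ℚ + 0ℚ) - (y + x) ≡ - (x + y)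
  simplify′ = solve-∀ ℚ-ring
  entries : (∃ λ a → p a ≡ i) → (∃ λ b → p b ≡ j) →
    (W (p zero) (p zero) + W (p (suc zero)) (p (suc zero))) -
    (W (p zero) (p (suc zero)) + W (p (suc zero)) (p zero)) ≡ - (W i j + W j i)
  entries (zero , refl)     (zero , refl)     = ⊥-elim (i≢j refl)
  entries (zero , refl)     (suc zero , refl) =
    trans (cong₂ (λ x y → (x + y) - (W i j + W j i)) Wii Wjj) (simplify (W i j) (W j i))
  entries (suc zero , refl) (zero , refl)     =
    trans (cong₂ (λ x y → (x + y) - (W j i + W i j)) Wjj Wii) (simplify′ (W i j) (W j i))
  entries (suc zero , refl) (suc zero , refl) = ⊥-elim (i≢j refl)
two-points {η = suc (suc (suc η))} W p {i} {j} inj i≢j a b only Wii Wjj =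
  ⊥-elim (collide (only zero) (only (suc zero)) (only (suc (suc zero))))
  where
  0≢1 : p zero ≢ p (suc zero)
  0≢1 e with () ← inj e
  0≢2 : p zero ≢ p (suc (suc zero))
  0≢2 e with () ← inj e
  1≢2 : p (suc zero) ≢ p (suc (suc zero))
  1≢2 e with () ← inj e
  collide : p zero ≡ i ⊎ p zero ≡ j → p (suc zero) ≡ i ⊎ p (suc zero) ≡ j →
            ¬ (p (suc (suc zero)) ≡ i ⊎ p (suc (suc zero)) ≡ j)
  collide (inj₁ x) (inj₁ y) z        = 0≢1 (trans x (sym y))
  collide (inj₂ x) (inj₂ y) z        = 0≢1 (trans x (sym y))
  collide (inj₁ x) (inj₂ y) (inj₁ z) = 0≢2 (trans x (sym z))
  collide (inj₁ x) (inj₂ y) (inj₂ z) = 1≢2 (trans y (sym z))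
  collide (inj₂ x) (inj₁ y) (inj₁ z) = 1≢2 (trans y (sym z))
  collide (inj₂ x) (inj₁ y) (inj₂ z) = 0≢2 (trans x (sym z))

resistance-diag : ∀ {n} (K : Matrix n n) i → resistance K i i ≡ 0ℚ
resistance-diag K i = lemma (K i i)
  where
  lemma : ∀ x → (x + x) - ((1ℚ + 1ℚ) * x) ≡ 0ℚ
  lemma = solve-∀ ℚ-ring

-- For equal subsets of size 2 the exponent 2a + 1 is odd, and its sign cancels the minus sign of
-- the cofactor sum.
pair-sign : ∀ {η a} κ x d → η ≡ 2 →
  κ * (- x) ≡ sgn ((a ℕ.+ a ℕ.+ η) ∸ 1) * (natℚ (2 ^ (η ∸ 1)) * d) → κ * x ≡ natℚ 2 * d
pair-sign {a = a} κ x d refl e = begin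
  κ * x                                              ≡⟨ l₁ κ x ⟩
  - (κ * (- x))                                      ≡⟨ cong -_ e ⟩
  - (sgn ((a ℕ.+ a ℕ.+ 2) ∸ 1) * (natℚ 2 * d))       ≡⟨ cong (λ s → - (s * (natℚ 2 * d))) sign ⟩
  - (- 1ℚ * (natℚ 2 * d))                            ≡⟨ l₂ (natℚ 2 * d) ⟩
  natℚ 2 * d                                         ∎
  where
  open ≡-Reasoning
  l₁ : ∀ κ x → κ * x ≡ - (κ * (- x))
  l₁ = solve-∀ ℚ-ring
  l₂ : ∀ x → - (- 1ℚ * x) ≡ x
  l₂ = solve-∀ ℚ-ring
  sign : sgn ((a ℕ.+ a ℕ.+ 2) ∸ 1) ≡ - 1ℚ
  sign = trans (cong (λ x → sgn (x ∸ 1)) (ℕₚ.+-suc (a ℕ.+ a) 1))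
    (trans (sgn-+ (a ℕ.+ a) 1) (trans (cong (_* - 1ℚ) (trans (sgn-+ a a) (sgn-square a))) (ℚₚ.*-identityˡ (- 1ℚ))))

theorem5p5 : ∀ {n} (A : Adj n) → Simple A → StronglyConnected A → Balanced A →
    (Ld : Matrix n n) → IsMoorePenrose (laplacian A) Ld →
    (root : Fin n) (T : List (Subgraph n)) → Unique T →
    (∀ H → (H ∈ T → IsOrientedSpanningTree A root H)
    × (IsOrientedSpanningTree A root H → H ∈ T)) →
    (∀ (Ω₁ Ω₂ : Subset n) (eq : ∣ Ω₁ ∣ ≡ ∣ Ω₂ ∣) → Nonempty Ω₁ → Nonempty Ω₂ →
    natℚ (length T) * cofsum (sub (resistance Ld) Ω₁ Ω₂ eq)
    ≡ sgn ((α Ω₁ ℕ.+ α Ω₂ ℕ.+ ∣ Ω₁ ∣) ∸ 1)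
    * (natℚ (2 ^ (∣ Ω₁ ∣ ∸ 1))
    * det (sub (laplacian A) (∁ Ω₂) (∁ Ω₁) (∣∁∣-eq Ω₂ Ω₁ (sym eq)))))
    × (∀ (i j : Fin n) → i ≢ j →
    natℚ (length T) * (resistance Ld i j + resistance Ld j i)
    ≡ natℚ 2 * det (sub (laplacian A) (∁ (pair i j)) (∁ (pair i j)) refl))
theorem5p5 {suc m} A _ connected balanced Ld mp root T unique trees =
  -- The position of a member of `Ω₁` in its enumeration shows that the size is positive, so the
  -- truncated subtractions of 1 are genuine.
  (λ Ω₁ Ω₂ eq (i , i∈Ω₁) _ → part-i Ω₁ Ω₂ eq (proj₁ (elems-onto Ω₁ i ([]=⇒lookup i∈Ω₁)))) , part-ii
  where
  part-i : ∀ (Ω₁ Ω₂ : Subset (suc m)) (eq : ∣ Ω₁ ∣ ≡ ∣ Ω₂ ∣) → Fin ∣ Ω₁ ∣ →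
    natℚ (length T) * cofsum (sub (resistance Ld) Ω₁ Ω₂ eq)
    ≡ sgn ((α Ω₁ ℕ.+ α Ω₂ ℕ.+ ∣ Ω₁ ∣) ∸ 1)
    * (natℚ (2 ^ (∣ Ω₁ ∣ ∸ 1)) * det (sub (laplacian A) (∁ Ω₂) (∁ Ω₁) (∣∁∣-eq Ω₂ Ω₁ (sym eq))))
  part-i Ω₁ Ω₂ eq x = trans
    (cong (_* cofsum (sub (resistance Ld) Ω₁ Ω₂ eq)) (matrix-tree A root T unique trees))
    (cofsum-subsets A connected balanced mp root Ω₁ Ω₂ eq x)
  part-ii : ∀ (i j : Fin (suc m)) → i ≢ j →
    natℚ (length T) * (resistance Ld i j + resistance Ld j i)
    ≡ natℚ 2 * det (sub (laplacian A) (∁ (pair i j)) (∁ (pair i j)) refl)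
  part-ii i j i≢j = pair-sign {a = α p} (natℚ (length T)) (resistance Ld i j + resistance Ld j i) _
    (proj₁ shape) (trans (cong (natℚ (length T) *_) (sym (proj₂ shape))) (part-i p p refl (proj₁ i∈)))
    where
    p : Subset (suc m)
    p = pair i j
    i∈ : ∃ λ a → elems p a ≡ i
    i∈ = elems-onto p i (pair-left i j)
    shape : ∣ p ∣ ≡ 2 × cofsum (sub (resistance Ld) p p refl) ≡ - (resistance Ld i j + resistance Ld j i)
    shape = two-points (resistance Ld) (elems p) (elems-injective p) i≢j i∈ (elems-onto p j (pair-right i j))
      (λ c → pair-member i j (elems p c) (elems-member p c)) (resistance-diag Ld i) (resistance-diag Ld j)
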